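{- Let $R$ be an irreducible root system of rank $m$ with set of positive roots $R_+$, simple roots $\alpha_1,\dots,\alpha_m$, and highest root $\tilde\alpha=\sum_{i=1}^m n_i\alpha_i$, and let $h = 1+\sum_{i=1}^m n_i$ (the Coxeter number). With $\chi_R$ and $\Phi_R$ as defined in the context, $$\Phi_R(t) = \frac{(n_1\cdots n_m)\,(m!)\, t^h}{(1-t)\prod_{i=1}^m (1-t^{n_i})}.$$
   Context: Let $n=|R|/2=|R_+|$ and let $S=[S_{ij}]$ be the $m\times n$ integer matrix whose columns are the coefficient vectors of the positive roots with respect to the simple roots, i.e. $R_+=\{\sum_{i=1}^m S_{ij}\alpha_i : j=1,\dots,n\}$ (columns in any order). For a positive integer $q$, let $\mathbb{Z}_q=\mathbb{Z}/q\mathbb{Z}$, $\mathbb{Z}_q^\times=\mathbb{Z}_q\setminus\{0\}$ (nonzero residues), and $\chi_R(q) = |\{\mathbf z\in\mathbb{Z}_q^m : \mathbf z S\in(\mathbb{Z}_q^\times)^n\}|$. The generating function is the formal power series $\Phi_R(t)=\sum_{q=1}^\infty \chi_R(q)\,t^q$. -}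

module Defs where

open import Data.Bool using (Bool; true; false)
open import Data.Nat as ℕ using (ℕ; zero; suc; _!)
import Data.Nat.Divisibility as ℕDiv
open import Data.Integer as ℤ using (ℤ; +_; -_; _+_; _-_; _*_; _≤_; _<_; ∣_∣; _≤?_)
open import Data.Fin using (Fin; toℕ)
open import Data.Vec as Vec using (Vec; []; _∷_; lookup; zipWith; replicate)
import Data.Vec.Relation.Unary.All as VAll
open import Data.List as List using (List; length; filter; concatMap; allFin; upTo)
import Data.List.Relation.Unary.All as LAll
open import Data.List.Membership.Propositional using (_∈_)
open import Data.List.Relation.Unary.Unique.Propositional using (Unique)
open import Data.Product using (Σ; ∃; _×_; _,_)
open import Data.Sum using (_⊎_)
open import Data.Empty using (⊥)
open import Relation.Nullary using (¬_; Dec; ¬?)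
open import Relation.Binary.PropositionalEquality using (_≡_; _≢_)

-- Linear algebra on ℤ^m (vectors = coordinate vectors w.r.t. the simple roots)

_·_ : ∀ {m} → Vec ℤ m → Vec ℤ m → ℤ
u · v = Vec.foldr _ _+_ (+ 0) (zipWith _*_ u v)

_•_ : ∀ {m} → ℤ → Vec ℤ m → Vec ℤ m
k • v = Vec.map (k *_) v

_⊖_ : ∀ {m} → Vec ℤ m → Vec ℤ m → Vec ℤ m
u ⊖ v = zipWith _-_ u v

basis : ∀ {m} → Fin m → Vec ℤ m
basis {m} i = Vec.tabulate (λ j → e i j)
  where
  open import Data.Fin using (_≟_)
  open import Relation.Nullary using (yes; no)
  e : Fin m → Fin m → ℤ
  e i j with i ≟ j
  ... | yes _ = + 1
  ... | no  _ = + 0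

-- Gram matrix (rows) of the inner product in the basis of simple roots:
-- form G u v = uᵀ G v
Gram : ℕ → Set
Gram m = Vec (Vec ℤ m) m

form : ∀ {m} → Gram m → Vec ℤ m → Vec ℤ m → ℤ
form G u v = u · Vec.map (λ row → row · v) G

Nonneg : ∀ {m} → Vec ℤ m → Set
Nonneg = VAll.All (λ x → + 0 ≤ x)

Nonpos : ∀ {m} → Vec ℤ m → Set
Nonpos = VAll.All (λ x → x ≤ + 0)

nonneg? : ∀ {m} (v : Vec ℤ m) → Dec (Nonneg v)
nonneg? = VAll.all? (λ x → + 0 ≤? x)

-- An irreducible (reduced, crystallographic) root system of rank m,
-- written in coordinates with respect to a base {α_1,…,α_m}: the roots
-- are the integer coefficient vectors, α_i is the standard basis vector
-- e_i, and the Euclidean inner product is given by the (integer-scaled)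
-- Gram matrix G of the simple roots.

record IsIrredRootSystem (m : ℕ) (G : Gram m) (R : List (Vec ℤ m)) : Set where
  field
    symmetric   : ∀ i j → lookup (lookup G i) j ≡ lookup (lookup G j) i
    posDef      : ∀ (v : Vec ℤ m) → v ≢ replicate m (+ 0) → + 0 < form G v v
    unique      : Unique R
    nonzero     : replicate m (+ 0) ∈ R → ⊥
    reduced     : ∀ α β → α ∈ R → β ∈ R → ∀ (a b : ℤ) → a ≢ + 0 →
                  a • β ≡ b • α → (b ≡ a) ⊎ (b ≡ - a)
    reflect     : ∀ α β → α ∈ R → β ∈ R →
                  Σ ℤ λ k → (k * form G α α ≡ + 2 * form G β α) × ((β ⊖ (k • α)) ∈ R)
    -- {e_1,…,e_m} is a base: simple roots are roots, and every root has
    -- all coefficients ≥ 0 or all ≤ 0 (so they span and are independent)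
    simpleRoots : ∀ i → basis i ∈ R
    signed      : ∀ β → β ∈ R → Nonneg β ⊎ Nonpos β
    irreducible : ¬ (Σ (Vec ℤ m → Bool) λ P →
                     (∃ λ α → α ∈ R × P α ≡ true) ×
                     (∃ λ β → β ∈ R × P β ≡ false) ×
                     (∀ α β → α ∈ R → β ∈ R → P α ≡ true → P β ≡ false →
                        form G α β ≡ + 0))

-- positive roots R₊ (the columns of S)
positiveRoots : ∀ {m} → List (Vec ℤ m) → List (Vec ℤ m)
positiveRoots R = filter nonneg? R

IsHighestRoot : ∀ {m} → List (Vec ℤ m) → Vec ℤ m → Set
IsHighestRoot R θ = θ ∈ positiveRoots R ×
                    (∀ β → β ∈ positiveRoots R → ∀ i → lookup β i ≤ lookup θ i)

-- all vectors z ∈ (ℤ_q)^m, with ℤ_q represented by Fin q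
allVecs : (m q : ℕ) → List (Vec (Fin q) m)
allVecs zero    q = List.[ [] ]
allVecs (suc m) q = concatMap (λ i → List.map (i ∷_) (allVecs m q)) (allFin q)

toℤvec : ∀ {m q} → Vec (Fin q) m → Vec ℤ m
toℤvec z = Vec.map (λ i → + toℕ i) z

-- (z S)_j ≠ 0 in ℤ_q for the column β
NonzeroMod : ∀ {m} (q : ℕ) → Vec (Fin q) m → Vec ℤ m → Set
NonzeroMod q z β = ¬ (q ℕDiv.∣ ∣ toℤvec z · β ∣)

nonzeroMod? : ∀ {m} (q : ℕ) (z : Vec (Fin q) m) (β : Vec ℤ m) → Dec (NonzeroMod q z β)
nonzeroMod? q z β = ¬? (q ℕDiv.∣? ∣ toℤvec z · β ∣)

Good : ∀ {m} (q : ℕ) → List (Vec ℤ m) → Vec (Fin q) m → Set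
Good q R z = LAll.All (NonzeroMod q z) (positiveRoots R)

good? : ∀ {m} (q : ℕ) (R : List (Vec ℤ m)) (z : Vec (Fin q) m) → Dec (Good q R z)
good? q R z = LAll.all? (nonzeroMod? q z) (positiveRoots R)

χ : ∀ {m} → List (Vec ℤ m) → ℕ → ℕ
χ {m} R q = length (filter (good? q R) (allVecs m q))

FPS : Set
FPS = ℕ → ℤ

sumℤ : List ℤ → ℤ
sumℤ = List.foldr _+_ (+ 0)

_⊛_ : FPS → FPS → FPS
(f ⊛ g) q = sumℤ (List.map (λ k → f k * g (q ℕ.∸ k)) (upTo (suc q)))

monomial : ℤ → ℕ → FPS
monomial c h q with q ℕ.≟ h
... | Relation.Nullary.yes _ = c
... | Relation.Nullary.no  _ = + 0

one : FPS
one = monomial (+ 1) 0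

oneMinusT^ : ℕ → FPS
oneMinusT^ k q = one q - monomial (+ 1) k q

Φ : ∀ {m} → List (Vec ℤ m) → FPS
Φ R zero    = + 0
Φ R (suc q) = + χ R (suc q)

prodFPS : List FPS → FPS
prodFPS = List.foldr _⊛_ one

prodℕ : List ℕ → ℕ
prodℕ = List.foldr ℕ._*_ 1

sumℕ : List ℕ → ℕ
sumℕ = List.foldr ℕ._+_ 0

{-# OPTIONS --safe #-}
-- A point z of ℤ^m is read as the coweight with (z, α_i) = z_i, so χ_R(q) counts the points of the box [0, q)^m that
-- avoid the hyperplanes (z, β) ∈ qℤ.  Affine reflections carry every point of the box into q times the open fundamental
-- alcove {z_i > 0, (z, θ) < q}, and a word of reflections that does so for z works for the whole alcove of z / q and,
-- with q replaced by p, for the same alcove dilated by p.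
-- Hence χ_R(q) = N c(q), where c(q) is the number of lattice points in the dilated fundamental alcove and N the number
-- of alcoves in a unit box.  Since ones is the only lattice point of the alcove dilated by h, one may take N = χ_R(h).
-- Because c(q) counts the z ≥ 1 with Σ n_i z_i < q, its generating function is t^h / ((1 - t) ∏ (1 - t^{n_i})), and
-- m! ∏ n_i c(q) = q^m + O(q^{m-1}); together with χ_R(q) = q^m + O(q^{m-1}) for q ≡ 1 mod (Σ n_i)! this forces
-- N = m! ∏ n_i.
module Submission where

open import Defs
open import Data.Nat as ℕ using (ℕ; zero; suc; _!)
import Data.Nat.Properties as ℕₚ
open import Data.Nat.Induction using (<-wellFounded; <-rec)
import Data.Nat.Divisibility as ℕᵈ
open import Data.Nat.Coprimality as Coprime using (Coprime)
open import Data.Integer as ℤ using (ℤ; +_; -[1+_]; ∣_∣)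
import Data.Integer.Properties as ℤₚ
import Data.Integer.Divisibility.Signed as ℤᵈ
import Data.Integer.Tactic.RingSolver as ℤSolver
open import Data.Fin as Fin using (Fin; toℕ; fromℕ<)
open import Data.Fin.Properties using (any?; toℕ<n; toℕ-fromℕ<; toℕ-injective; suc-injective)
open import Data.List as List
  using (List; []; _∷_; _++_; length; filter; concatMap; cartesianProduct; applyUpTo; upTo; map; allFin)
open import Data.List.Properties
  using (length-map; length-++; length-++-sucʳ; length-filter; length-tabulate; map-∘; map-tabulate; map-applyUpTo)
open import Data.List.Membership.Propositional using (_∈_; find; lose)
open import Data.List.Membership.Propositional.Properties
  using (∈-map⁺; ∈-map⁻; ∈-filter⁺; ∈-filter⁻; ∈-concatMap⁺; ∈-concatMap⁻; ∈-upTo⁺; ∈-allFin;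
         ∈-cartesianProduct⁺; ∈-cartesianProduct⁻; ∈-∃++; ∈-++⁺ˡ; ∈-++⁺ʳ; ∈-++⁻)
open import Data.List.Membership.Propositional.Properties.WithK using (unique∧set⇒bag)
open import Data.List.Relation.Binary.BagAndSetEquality using (∼bag⇒↭)
open import Data.List.Relation.Binary.Permutation.Propositional as Perm using (_↭_)
import Data.List.Relation.Binary.Permutation.Propositional.Properties as Perm
import Data.List.Relation.Unary.All as LAll
import Data.List.Relation.Unary.All.Properties as LAll
open import Data.List.Relation.Unary.AllPairs using ([]; _∷_)
open import Data.List.Relation.Unary.Any using (here; there)
open import Data.List.Relation.Unary.Unique.Propositional using (Unique)
import Data.List.Relation.Unary.Unique.Propositional.Properties as Unique
open import Data.Vec as Vec using (Vec; []; _∷_; lookup; replicate; tabulate; removeAt; insertAt)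
open import Data.Vec.Properties using (lookup∘tabulate; lookup-map; lookup-replicate; insertAt-removeAt; ∷-injective)
open import Data.Vec.Relation.Unary.All using ([]; _∷_)
open import Data.Vec.Relation.Unary.All.Properties using (lookup⁺; lookup⁻)
open import Data.Product using (Σ; _×_; _,_; proj₁; proj₂)
open import Data.Sum using (_⊎_; inj₁; inj₂)
open import Function using (_∘_; id; mk⇔)
open import Induction.WellFounded using (Acc; acc)
open import Relation.Nullary using (¬_; ¬?; yes; no; contradiction)
open import Relation.Nullary.Decidable using (decidable-stable)
open import Relation.Binary.PropositionalEquality

-- Division by `q` never takes place: the alcove of `z / q` is recorded by the integers `k` with
-- `k q < (z, γ) < (k + 1) q`, one for each root `γ`, and points at different scales are compared
-- through them. An affine reflection permutes the roots and moves these integers by amounts free of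
-- `q`, which is why one word serves every scale. Folding needs a terminating measure. The sum over
-- all roots of squared pairings is an invariant quadratic form with integer values, so the distance
-- to `ones / h`, cleared of denominators, is a natural number. The congruence on `q` controls the
-- zeros of a positive root modulo `q`. Some coefficient of the root lies between `1` and `Σ nᵢ`,
-- hence divides `(Σ nᵢ)!` and is a unit modulo `q`; the remaining coordinates of a zero determine
-- the coordinate there, so there are at most `q^(m-1)` zeros. As `N` does not depend on `q`, one
-- infinite progression determines it.

module AlcoveGeometry where
  open import Data.Integer using (-_; _+_; _-_; _*_; _≤_; _<_)
  open import Data.Integer.Tactic.RingSolver using (solve-∀)
  open import Data.Integer.Divisibility.Signed using (_∣_; divides)

  -- Integer inequalities, coordinate vectors and sums over lists.

  *-pos : ∀ {a b} → + 0 < a → + 0 < b → + 0 < a * b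
  *-pos {+ suc a} {+ suc b} _ _ = ℤ.+<+ (ℕ.s≤s ℕ.z≤n)
  *-pos {+ zero} (ℤ.+<+ ())
  *-pos {+ suc a} {+ zero} _ (ℤ.+<+ ())

  1<x : ∀ x → + 0 < x → x ≢ + 1 → + 1 < x
  1<x x 0<x x≢1 = ℤₚ.≤∧≢⇒< (ℤₚ.i<j⇒suc[i]≤j 0<x) (x≢1 ∘ sym)

  ·-comm : ∀ {m} (u v : Vec ℤ m) → u · v ≡ v · u
  ·-comm []      []      = refl
  ·-comm (x ∷ u) (y ∷ v) = cong₂ _+_ (ℤₚ.*-comm x y) (·-comm u v)

  ·-reflectʳ : ∀ {m} (z u v : Vec ℤ m) c → z · (u ⊖ (c • v)) ≡ z · u - c * (z · v)
  ·-reflectʳ []      []      []      c = sym (cong (λ t → + 0 - t) (ℤₚ.*-zeroʳ c))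
  ·-reflectʳ (x ∷ z) (y ∷ u) (w ∷ v) c =
    trans (cong (λ t → x * (y - c * w) + t) (·-reflectʳ z u v c)) (lemma x y w c (z · u) (z · v))
    where
    lemma : ∀ x y w c p q → x * (y - c * w) + (p - c * q) ≡ (x * y + p) - c * (x * w + q)
    lemma = solve-∀

  ·-reflectˡ : ∀ {m} (u v z : Vec ℤ m) c → (u ⊖ (c • v)) · z ≡ u · z - c * (v · z)
  ·-reflectˡ u v z c = begin
    (u ⊖ (c • v)) · z     ≡⟨ ·-comm (u ⊖ (c • v)) z ⟩
    z · (u ⊖ (c • v))     ≡⟨ ·-reflectʳ z u v c ⟩
    z · u - c * (z · v)   ≡⟨ cong₂ (λ s t → s - c * t) (·-comm z u) (·-comm z v) ⟩
    u · z - c * (v · z)   ∎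
    where open ≡-Reasoning

  ⊖•-cancel : ∀ {m} (u v : Vec ℤ m) a b → a + b ≡ + 0 → (u ⊖ (a • v)) ⊖ (b • v) ≡ u
  ⊖•-cancel []      []      a b eq = refl
  ⊖•-cancel (x ∷ u) (y ∷ v) a b eq =
    cong₂ _∷_ (trans (lemma x y a b) (trans (cong (λ t → x - t * y) eq) (lemma₀ x y))) (⊖•-cancel u v a b eq)
    where
    lemma : ∀ x y a b → (x - a * y) - b * y ≡ x - (a + b) * y
    lemma = solve-∀
    lemma₀ : ∀ x y → x - + 0 * y ≡ x
    lemma₀ = solve-∀

  lookup-⊖• : ∀ {m} (u v : Vec ℤ m) c i → lookup (u ⊖ (c • v)) i ≡ lookup u i - c * lookup v i
  lookup-⊖• (x ∷ u) (y ∷ v) c Fin.zero    = refl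
  lookup-⊖• (x ∷ u) (y ∷ v) c (Fin.suc i) = lookup-⊖• u v c i

  lookup-extensional : ∀ {m} (u v : Vec ℤ m) → (∀ i → lookup u i ≡ lookup v i) → u ≡ v
  lookup-extensional []      []      eq = refl
  lookup-extensional (x ∷ u) (y ∷ v) eq = cong₂ _∷_ (eq Fin.zero) (lookup-extensional u v (eq ∘ Fin.suc))

  -- The entry function of `basis` is local to its definition; letting `refl` solve the hole makes
  -- it available, and a case split on `i Fin.≟ j` reduces it.
  basisEntry : ∀ {m} (i : Fin m) → Σ (Fin m → ℤ) λ f → basis i ≡ tabulate f
  basisEntry i = _ , refl

  basisEntry-≡ : ∀ {m} (i : Fin m) → proj₁ (basisEntry i) i ≡ + 1
  basisEntry-≡ i with i Fin.≟ i
  ... | yes _  = refl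
  ... | no i≢i = contradiction refl i≢i

  basisEntry-≢ : ∀ {m} {i j : Fin m} → i ≢ j → proj₁ (basisEntry i) j ≡ + 0
  basisEntry-≢ {i = i} {j} i≢j with i Fin.≟ j
  ... | yes i≡j = contradiction i≡j i≢j
  ... | no _    = refl

  lookup-basis-≡ : ∀ {m} (i : Fin m) → lookup (basis i) i ≡ + 1
  lookup-basis-≡ i = trans (lookup∘tabulate (proj₁ (basisEntry i)) i) (basisEntry-≡ i)

  lookup-basis-≢ : ∀ {m} {i j : Fin m} → i ≢ j → lookup (basis i) j ≡ + 0
  lookup-basis-≢ {i = i} {j} i≢j = trans (lookup∘tabulate (proj₁ (basisEntry i)) j) (basisEntry-≢ i≢j)

  ·-zeroˡ : ∀ {m} (u v : Vec ℤ m) → (∀ i → lookup u i ≡ + 0) → u · v ≡ + 0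
  ·-zeroˡ []      []      eq = refl
  ·-zeroˡ (x ∷ u) (y ∷ v) eq = cong₂ (λ s t → s * y + t) (eq Fin.zero) (·-zeroˡ u v (eq ∘ Fin.suc))

  ·-unitˡ : ∀ {m} (u v : Vec ℤ m) i → lookup u i ≡ + 1 → (∀ {j} → i ≢ j → lookup u j ≡ + 0) →
            u · v ≡ lookup v i
  ·-unitˡ (x ∷ u) (y ∷ v) Fin.zero    eq₁ eq₀ =
    trans (cong₂ (λ s t → s * y + t) eq₁ (·-zeroˡ u v (λ i → eq₀ {Fin.suc i} λ ())))
          (trans (ℤₚ.+-identityʳ _) (ℤₚ.*-identityˡ y))
  ·-unitˡ (x ∷ u) (y ∷ v) (Fin.suc i) eq₁ eq₀ =
    trans (cong₂ (λ s t → s * y + t) (eq₀ {Fin.zero} λ ()) (·-unitˡ u v i eq₁ (λ {j} i≢j → eq₀ {Fin.suc j} (i≢j ∘ suc-injective))))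
          (ℤₚ.+-identityˡ _)

  basis-· : ∀ {m} (i : Fin m) (v : Vec ℤ m) → basis i · v ≡ lookup v i
  basis-· i v = ·-unitˡ (basis i) v i (lookup-basis-≡ i) lookup-basis-≢

  ·-basis : ∀ {m} (v : Vec ℤ m) (i : Fin m) → v · basis i ≡ lookup v i
  ·-basis v i = trans (·-comm v (basis i)) (basis-· i v)

  -- Linear extension: this lets a coroot known only on the simple roots be evaluated on every root.
  ·-proportional : ∀ {m} (u v w : Vec ℤ m) a b → (∀ i → lookup v i * a ≡ b * lookup w i) →
                   (u · v) * a ≡ b * (u · w)
  ·-proportional []      []      []      a b eq = trans (ℤₚ.*-zeroˡ a) (sym (ℤₚ.*-zeroʳ b))
  ·-proportional (x ∷ u) (y ∷ v) (z ∷ w) a b eq = begin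
    (x * y + u · v) * a           ≡⟨ lemma₁ x y (u · v) a ⟩
    x * (y * a) + (u · v) * a     ≡⟨ cong₂ (λ s t → x * s + t) (eq Fin.zero) (·-proportional u v w a b (eq ∘ Fin.suc)) ⟩
    x * (b * z) + b * (u · w)     ≡⟨ lemma₂ x b z (u · w) ⟩
    b * (x * z + u · w)           ∎
    where
    open ≡-Reasoning
    lemma₁ : ∀ x y p a → (x * y + p) * a ≡ x * (y * a) + p * a
    lemma₁ = solve-∀
    lemma₂ : ∀ x b z p → x * (b * z) + b * p ≡ b * (x * z + p)
    lemma₂ = solve-∀

  Positive : ∀ {m} → Vec ℤ m → Set
  Positive z = ∀ i → + 0 < lookup z i

  positive-· : ∀ {m} {z v : Vec ℤ m} → Positive z → Nonneg v → v ≡ replicate m (+ 0) ⊎ + 0 < z · v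
  positive-· {z = []}    {[]}    z>0 []          = inj₁ refl
  positive-· {z = x ∷ z} {y ∷ v} z>0 (y≥0 ∷ v≥0) with positive-· {z = z} (z>0 ∘ Fin.suc) v≥0 | y ℤ.≟ + 0
  ... | inj₁ v≡0 | yes refl = inj₁ (cong (+ 0 ∷_) v≡0)
  ... | inj₂ v>0 | yes refl = inj₂ (subst (λ t → + 0 < t + z · v) (sym (ℤₚ.*-zeroʳ x)) (subst (+ 0 <_) (sym (ℤₚ.+-identityˡ _)) v>0))
  ... | inj₁ v≡0 | no y≢0   = inj₂ (subst (λ t → + 0 < x * y + t)
          (sym (trans (·-comm z v) (·-zeroˡ v z (λ i → trans (cong (λ w → lookup w i) v≡0) (lookup-replicate i (+ 0))))))
          (subst (+ 0 <_) (sym (ℤₚ.+-identityʳ _)) (*-pos (z>0 Fin.zero) (ℤₚ.≤∧≢⇒< y≥0 (y≢0 ∘ sym)))))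
  ... | inj₂ v>0 | no y≢0   = inj₂ (ℤₚ.+-mono-< (*-pos (z>0 Fin.zero) (ℤₚ.≤∧≢⇒< y≥0 (y≢0 ∘ sym))) v>0)

  ·-monoʳ-≤ : ∀ {m} {z u v : Vec ℤ m} → Positive z → (∀ i → lookup u i ≤ lookup v i) → z · u ≤ z · v
  ·-monoʳ-≤ {z = []}    {[]}    {[]}    z>0 u≤v = ℤₚ.≤-refl
  ·-monoʳ-≤ {z = x ∷ z} {_ ∷ u} {_ ∷ v} z>0 u≤v =
    ℤₚ.+-mono-≤ (ℤₚ.*-monoˡ-≤-nonNeg x {{ℤ.nonNegative (ℤₚ.<⇒≤ (z>0 Fin.zero))}} (u≤v Fin.zero))
                (·-monoʳ-≤ {z = z} (z>0 ∘ Fin.suc) (u≤v ∘ Fin.suc))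

  ones : ∀ {m} → Vec ℤ m
  ones = replicate _ (+ 1)

  ones-positive : ∀ {m} → Positive {m} ones
  ones-positive i = subst (+ 0 <_) (sym (lookup-replicate i (+ 1))) (ℤ.+<+ (ℕ.s≤s ℕ.z≤n))

  ones-minimal : ∀ {m} {z v : Vec ℤ m} → Positive z → Positive v → z ≡ ones ⊎ ones · v < z · v
  ones-minimal {z = []}    {[]}    z>0 v>0 = inj₁ refl
  ones-minimal {z = x ∷ z} {y ∷ v} z>0 v>0 with ones-minimal {z = z} {v} (z>0 ∘ Fin.suc) (v>0 ∘ Fin.suc) | x ℤ.≟ + 1
  ... | inj₁ z≡1 | yes refl = inj₁ (cong (+ 1 ∷_) z≡1)
  ... | inj₂ lt  | yes refl = inj₂ (ℤₚ.+-monoʳ-< (+ 1 * y) lt)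
  ... | inj₁ refl | no x≢1  = inj₂ (ℤₚ.+-monoˡ-< (ones · v) (ℤₚ.*-monoʳ-<-pos y {{ℤ.positive (v>0 Fin.zero)}} (1<x x (z>0 Fin.zero) x≢1)))
  ... | inj₂ lt  | no x≢1   = inj₂ (ℤₚ.+-mono-< (ℤₚ.*-monoʳ-<-pos y {{ℤ.positive (v>0 Fin.zero)}} (1<x x (z>0 Fin.zero) x≢1)) lt)

  lookup-ones : ∀ {m} (i : Fin m) → lookup ones i ≡ + 1
  lookup-ones i = lookup-replicate i (+ 1)

  unique⇒↭ : ∀ {A : Set} {xs ys : List A} → Unique xs → Unique ys →
             (∀ {x} → x ∈ xs → x ∈ ys) → (∀ {x} → x ∈ ys → x ∈ xs) → xs ↭ ys
  unique⇒↭ u v f g = ∼bag⇒↭ (unique∧set⇒bag u v (mk⇔ f g))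

  sumℤ-↭ : ∀ {xs ys} → xs ↭ ys → sumℤ xs ≡ sumℤ ys
  sumℤ-↭ Perm.refl = refl
  sumℤ-↭ (Perm.prep x p) = cong (_+_ x) (sumℤ-↭ p)
  sumℤ-↭ (Perm.swap x y p) = trans (cong (λ t → x + (y + t)) (sumℤ-↭ p)) (lemma x y _)
    where
    lemma : ∀ x y t → x + (y + t) ≡ y + (x + t)
    lemma = solve-∀
  sumℤ-↭ (Perm.trans p q) = trans (sumℤ-↭ p) (sumℤ-↭ q)

  sumOver : ∀ {A : Set} → List A → (A → ℤ) → ℤ
  sumOver xs f = sumℤ (List.map f xs)

  -- Three terms are what the square of `x - C * y` expands into.
  sumOver-linear : ∀ {A : Set} (xs : List A) {f g h k : A → ℤ} (a b c : ℤ) →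
                   (∀ x → f x ≡ a * g x + b * h x + c * k x) →
                   sumOver xs f ≡ a * sumOver xs g + b * sumOver xs h + c * sumOver xs k
  sumOver-linear []       a b c eq = sym (cong₂ _+_ (cong₂ _+_ (ℤₚ.*-zeroʳ a) (ℤₚ.*-zeroʳ b)) (ℤₚ.*-zeroʳ c))
  sumOver-linear (x ∷ xs) {g = g} {h} {k} a b c eq =
    trans (cong₂ _+_ (eq x) (sumOver-linear xs {g = g} {h} {k} a b c eq)) (lemma a b c _ _ _ _ _ _)
    where
    lemma : ∀ a b c x y z u v w → (a * x + b * y + c * z) + (a * u + b * v + c * w) ≡
            a * (x + u) + b * (y + v) + c * (z + w)
    lemma = solve-∀

  sumOver-nonneg : ∀ {A : Set} (xs : List A) {f : A → ℤ} → (∀ x → + 0 ≤ f x) → + 0 ≤ sumOver xs f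
  sumOver-nonneg []       f≥0 = ℤₚ.≤-refl
  sumOver-nonneg (x ∷ xs) f≥0 = ℤₚ.+-mono-≤ (f≥0 x) (sumOver-nonneg xs f≥0)

  sumOver-positive : ∀ {A : Set} {xs : List A} {f : A → ℤ} {x} → (∀ x → + 0 ≤ f x) → x ∈ xs → + 0 < f x →
                     + 0 < sumOver xs f
  sumOver-positive {xs = x ∷ xs} f≥0 (here refl) fx>0 = ℤₚ.+-mono-<-≤ fx>0 (sumOver-nonneg xs f≥0)
  sumOver-positive {xs = x ∷ xs} f≥0 (there x∈)  fx>0 = ℤₚ.+-mono-≤-< (f≥0 x) (sumOver-positive f≥0 x∈ fx>0)

  0≤x*x : ∀ x → + 0 ≤ x * x
  0≤x*x (+ n)    = subst (+ 0 ≤_) (ℤₚ.pos-* n n) (ℤ.+≤+ ℕ.z≤n)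
  0≤x*x -[1+ n ] = ℤ.+≤+ ℕ.z≤n

  ∣∣-mono-< : ∀ {a b} → + 0 ≤ a → a < b → ∣ a ∣ ℕ.< ∣ b ∣
  ∣∣-mono-< {+ a} {+ b} _ (ℤ.+<+ lt) = lt
  ∣∣-mono-< { -[1+ _ ]} ()

  i-j<i : ∀ i {j} → + 0 < j → i - j < i
  i-j<i i {j} 0<j = subst (i - j <_) (ℤₚ.+-identityʳ i) (ℤₚ.+-monoʳ-< i (ℤₚ.neg-mono-< 0<j))

  i<j⇒0<j-i : ∀ {i j} → i < j → + 0 < j - i
  i<j⇒0<j-i {i} {j} i<j = subst (_< j - i) (ℤₚ.+-inverseʳ i) (ℤₚ.+-monoˡ-< (- i) i<j)

  *-pos-neg : ∀ {a b} → + 0 < - a → + 0 < - b → + 0 < a * b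
  *-pos-neg {a} {b} a<0 b<0 = subst (+ 0 <_) (lemma a b) (*-pos a<0 b<0)
    where
    lemma : ∀ a b → - a * - b ≡ a * b
    lemma = solve-∀

  -- Cells between multiples of `q`, and affine reflections acting on them.

  record Between (k q x : ℤ) : Set where
    constructor _≪_
    field
      lower : k * q < x
      upper : x < (k + + 1) * q

  between-shift : ∀ {k q x} j → Between k q x → Between (k + j) q (x + j * q)
  between-shift {k} {q} {x} j (l ≪ u) =
    subst (_< x + j * q) (lemma₁ k j q) (ℤₚ.+-monoˡ-< (j * q) l) ≪
    subst (x + j * q <_) (lemma₂ k j q) (ℤₚ.+-monoˡ-< (j * q) u)
    where
    lemma₁ : ∀ k j q → k * q + j * q ≡ (k + j) * q
    lemma₁ = solve-∀
    lemma₂ : ∀ k j q → (k + + 1) * q + j * q ≡ (k + j + + 1) * q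
    lemma₂ = solve-∀

  between-neg : ∀ {k q x} → Between k q x → Between (- (k + + 1)) q (- x)
  between-neg {k} {q} {x} (l ≪ u) =
    subst (_< - x) (lemma₁ k q) (ℤₚ.neg-mono-< u) ≪
    subst (- x <_) (lemma₂ k q) (ℤₚ.neg-mono-< l)
    where
    lemma₁ : ∀ k q → - ((k + + 1) * q) ≡ - (k + + 1) * q
    lemma₁ = solve-∀
    lemma₂ : ∀ k q → - (k * q) ≡ (- (k + + 1) + + 1) * q
    lemma₂ = solve-∀

  i<j+1⇒i≤j : ∀ {i j} → i < j + + 1 → i ≤ j
  i<j+1⇒i≤j {i} {j} lt = ℤₚ.≤-trans (ℤₚ.i<j⇒i≤pred[j] lt) (ℤₚ.≤-reflexive (lemma j))
    where
    lemma : ∀ j → - (+ 1) + (j + + 1) ≡ j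
    lemma = solve-∀

  between-≤ : ∀ {q x i j} → + 0 < q → i * q ≤ x → x < (j + + 1) * q → i ≤ j
  between-≤ {q} 0<q l u =
    i<j+1⇒i≤j (ℤₚ.*-cancelʳ-<-nonNeg q {{ℤ.nonNegative (ℤₚ.<⇒≤ 0<q)}} (ℤₚ.≤-<-trans l u))

  between-unique : ∀ {q x i j} → + 0 < q → Between i q x → Between j q x → i ≡ j
  between-unique 0<q (l ≪ u) (l′ ≪ u′) = ℤₚ.≤-antisym (between-≤ 0<q (ℤₚ.<⇒≤ l) u′) (between-≤ 0<q (ℤₚ.<⇒≤ l′) u)

  between⇒∤ : ∀ {k q x} → + 0 < q → Between k q x → ¬ q ∣ x
  between⇒∤ {k} {q} 0<q (l ≪ u) (divides j refl) =
    ℤₚ.<⇒≱ (cancel k j l) (i<j+1⇒i≤j (cancel j (k + + 1) u))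
    where
    cancel : ∀ a b → a * q < b * q → a < b
    cancel a b = ℤₚ.*-cancelʳ-<-nonNeg q {{ℤ.nonNegative (ℤₚ.<⇒≤ 0<q)}}

  -- The affine hyperplanes z · root = level * q for all q at once: a mirror acts on coweights z, scaled by any q.
  record Mirror {m} (R : List (Vec ℤ m)) : Set where
    field
      root coroot : Vec ℤ m
      level       : ℤ
      root∈R      : root ∈ R
      pairing     : coroot · root ≡ + 2
      closed      : ∀ {γ} → γ ∈ R → γ ⊖ ((coroot · γ) • root) ∈ R

    reflectRoot : Vec ℤ m → Vec ℤ m
    reflectRoot γ = γ ⊖ ((coroot · γ) • root)

    offset : ℤ → Vec ℤ m → ℤ
    offset q z = z · root - level * q

    reflection : ℤ → Vec ℤ m → Vec ℤ m
    reflection q z = z ⊖ (offset q z • coroot)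

    coroot-reflectRoot : ∀ γ → coroot · reflectRoot γ ≡ - (coroot · γ)
    coroot-reflectRoot γ = begin
      coroot · reflectRoot γ                              ≡⟨ ·-reflectʳ coroot γ root (coroot · γ) ⟩
      coroot · γ - (coroot · γ) * (coroot · root)         ≡⟨ cong (λ t → coroot · γ - (coroot · γ) * t) pairing ⟩
      coroot · γ - (coroot · γ) * + 2                     ≡⟨ lemma (coroot · γ) ⟩
      - (coroot · γ)                                      ∎
      where
      open ≡-Reasoning
      lemma : ∀ x → x - x * + 2 ≡ - x
      lemma = solve-∀

    reflectRoot-involutive : ∀ γ → reflectRoot (reflectRoot γ) ≡ γ
    reflectRoot-involutive γ = ⊖•-cancel γ root (coroot · γ) (coroot · reflectRoot γ)
      (trans (cong (_+_ (coroot · γ)) (coroot-reflectRoot γ)) (ℤₚ.+-inverseʳ (coroot · γ)))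

    reflectRoot-↭ : Unique R → List.map reflectRoot R ↭ R
    reflectRoot-↭ unique = unique⇒↭ (Unique.map⁺ injective unique) unique to from
      where
      injective : ∀ {γ δ} → reflectRoot γ ≡ reflectRoot δ → γ ≡ δ
      injective {γ} {δ} eq =
        trans (sym (reflectRoot-involutive γ)) (trans (cong reflectRoot eq) (reflectRoot-involutive δ))
      to : ∀ {γ} → γ ∈ List.map reflectRoot R → γ ∈ R
      to γ∈ with _ , δ∈R , refl ← ∈-map⁻ reflectRoot γ∈ = closed δ∈R
      from : ∀ {γ} → γ ∈ R → γ ∈ List.map reflectRoot R
      from {γ} γ∈R = subst (_∈ List.map reflectRoot R) (reflectRoot-involutive γ) (∈-map⁺ reflectRoot (closed γ∈R))

    -- The affine reflection crosses the pairing onto the root at the cost of a multiple of `q`. The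
    -- multiplier `level * (coroot · γ)` is an integer free of `q`, so genericity is preserved and
    -- cells at two scales move in step.
    reflection-· : ∀ q z γ → reflection q z · γ ≡ z · reflectRoot γ + (level * (coroot · γ)) * q
    reflection-· q z γ = begin
      reflection q z · γ
        ≡⟨ ·-reflectˡ z coroot γ (offset q z) ⟩
      z · γ - (z · root - level * q) * (coroot · γ)
        ≡⟨ lemma (z · γ) (z · root) level q (coroot · γ) ⟩
      (z · γ - (coroot · γ) * (z · root)) + (level * (coroot · γ)) * q
        ≡⟨ cong (_+ (level * (coroot · γ)) * q) (·-reflectʳ z γ root (coroot · γ)) ⟨
      z · reflectRoot γ + (level * (coroot · γ)) * q ∎
      where
      open ≡-Reasoning
      lemma : ∀ a b k q c → a - (b - k * q) * c ≡ (a - c * b) + (k * c) * q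
      lemma = solve-∀

    offset-reflection : ∀ q z → offset q z + offset q (reflection q z) ≡ + 0
    offset-reflection q z = begin
      offset q z + (reflection q z · root - level * q)
        ≡⟨ cong (λ t → offset q z + (t - level * q)) (·-reflectˡ z coroot root (offset q z)) ⟩
      offset q z + ((z · root - offset q z * (coroot · root)) - level * q)
        ≡⟨ cong (λ t → offset q z + ((z · root - offset q z * t) - level * q)) pairing ⟩
      offset q z + ((z · root - offset q z * + 2) - level * q)
        ≡⟨ lemma (z · root) (level * q) ⟩
      + 0 ∎
      where
      open ≡-Reasoning
      lemma : ∀ a b → (a - b) + ((a - (a - b) * + 2) - b) ≡ + 0
      lemma = solve-∀

    reflection-involutive : ∀ q z → reflection q (reflection q z) ≡ z
    reflection-involutive q z = ⊖•-cancel z coroot (offset q z) (offset q (reflection q z)) (offset-reflection q z)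

  open Mirror

  Word : ∀ {m} → List (Vec ℤ m) → Set
  Word R = List (Mirror R)

  act : ∀ {m} {R : List (Vec ℤ m)} → ℤ → Word R → Vec ℤ m → Vec ℤ m
  act q []      z = z
  act q (μ ∷ w) z = act q w (reflection μ q z)

  unact : ∀ {m} {R : List (Vec ℤ m)} → ℤ → Word R → Vec ℤ m → Vec ℤ m
  unact q []      z = z
  unact q (μ ∷ w) z = reflection μ q (unact q w z)

  act-unact : ∀ {m} {R : List (Vec ℤ m)} q (w : Word R) z → act q w (unact q w z) ≡ z
  act-unact q []      z = refl
  act-unact q (μ ∷ w) z = trans (cong (act q w) (reflection-involutive μ q (unact q w z))) (act-unact q w z)

  unact-act : ∀ {m} {R : List (Vec ℤ m)} q (w : Word R) z → unact q w (act q w z) ≡ z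
  unact-act q []      z = refl
  unact-act q (μ ∷ w) z =
    trans (cong (reflection μ q) (unact-act q w (reflection μ q z))) (reflection-involutive μ q z)

  Generic : ∀ {m} → List (Vec ℤ m) → ℤ → Vec ℤ m → Set
  Generic R q z = ∀ {γ} → γ ∈ R → ¬ q ∣ z · γ

  -- z / q and y / p lie in the same alcove.
  SameAlcove : ∀ {m} → List (Vec ℤ m) → ℤ → Vec ℤ m → ℤ → Vec ℤ m → Set
  SameAlcove R q z p y = ∀ {γ} → γ ∈ R → Σ ℤ λ k → Between k q (z · γ) × Between k p (y · γ)

  module _ {m : ℕ} {R : List (Vec ℤ m)} where

    reflection-generic : ∀ (μ : Mirror R) {q z} → Generic R q z → Generic R q (reflection μ q z)
    reflection-generic μ {q} {z} gen {γ} γ∈R q∣ = gen (closed μ γ∈R)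
      (ℤᵈ.∣m+n∣n⇒∣m {q} {z · reflectRoot μ γ} (subst (q ∣_) (reflection-· μ q z γ) q∣) (divides (level μ * (coroot μ · γ)) refl))

    same-sym : ∀ {q z p y} → SameAlcove R q z p y → SameAlcove R p y q z
    same-sym same γ∈R with k , b , b′ ← same γ∈R = k , b′ , b

    same-trans : ∀ {q z p y r x} → + 0 < p → SameAlcove R q z p y → SameAlcove R p y r x → SameAlcove R q z r x
    same-trans {r = r} {x} 0<p s s′ {γ} γ∈R with k , b , b′ ← s γ∈R | k′ , c , c′ ← s′ γ∈R =
      k , b , subst (λ k → Between k r (x · γ)) (between-unique 0<p c b′) c′

    same⇒generic : ∀ {q z p y} → + 0 < q → SameAlcove R q z p y → Generic R q z
    same⇒generic 0<q same γ∈R with k , b , _ ← same γ∈R = between⇒∤ {k} 0<q b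

    reflection-same : ∀ (μ : Mirror R) {q z p y} → SameAlcove R q z p y →
                      SameAlcove R q (reflection μ q z) p (reflection μ p y)
    reflection-same μ {q} {z} {p} {y} same {γ} γ∈R with k , b , b′ ← same (closed μ γ∈R) =
      k + j , move q z b , move p y b′
      where
      j = level μ * (coroot μ · γ)
      move : ∀ q z → Between k q (z · reflectRoot μ γ) → Between (k + j) q (reflection μ q z · γ)
      move q z b = subst (Between (k + j) q) (sym (reflection-· μ q z γ)) (between-shift {k} j b)

    act-same : ∀ (w : Word R) {q z p y} → SameAlcove R q z p y → SameAlcove R q (act q w z) p (act p w y)
    act-same []      same = same
    act-same (μ ∷ w) {q} {z} {p} {y} same =
      act-same w {q} {reflection μ q z} {p} {reflection μ p y} (reflection-same μ {q} {z} {p} {y} same)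

    unact-same : ∀ (w : Word R) {q z p y} → SameAlcove R q z p y → SameAlcove R q (unact q w z) p (unact p w y)
    unact-same []      same = same
    unact-same (μ ∷ w) {q} {z} {p} {y} same =
      reflection-same μ {q} {unact q w z} {p} {unact p w y} (unact-same w {q} {z} {p} {y} same)

    -- Up to scaling, potential p q z is the W-invariant squared distance from z / q to ones / p.
    module _ (p q : ℤ) where

      displacement : Vec ℤ m → Vec ℤ m → ℤ
      displacement z γ = p * (z · γ) - q * (ones · γ)

      potential : Vec ℤ m → ℤ
      potential z = sumOver R (λ γ → displacement z γ * displacement z γ)

      potential-nonneg : ∀ z → + 0 ≤ potential z
      potential-nonneg z = sumOver-nonneg R (λ γ → 0≤x*x (displacement z γ))

      module _ (unique : Unique R) (μ : Mirror R) (z : Vec ℤ m) where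

        private
          d = displacement z
          c = coroot μ ·_
          ρ = root μ
          s = reflectRoot μ
          B = sumOver R (λ γ → d γ * c γ)
          N = sumOver R (λ γ → c γ * c γ)
          C = p * offset μ q z

          displacement-reflectRoot : ∀ γ → d (s γ) ≡ d γ - c γ * d ρ
          displacement-reflectRoot γ =
            trans (cong₂ (λ a b → p * a - q * b) (·-reflectʳ z γ ρ (c γ)) (·-reflectʳ ones γ ρ (c γ)))
                  (lemma p q (z · γ) (ones · γ) (c γ) (z · ρ) (ones · ρ))
            where
            lemma : ∀ p q a b c r t → p * (a - c * r) - q * (b - c * t) ≡ (p * a - q * b) - c * (p * r - q * t)
            lemma = solve-∀

          displacement-reflection : ∀ γ → displacement (reflection μ q z) γ ≡ d γ - C * c γ
          displacement-reflection γ =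
            trans (cong (λ t → p * t - q * (ones · γ)) (·-reflectˡ z (coroot μ) γ (offset μ q z)))
                  (lemma p q (z · γ) (ones · γ) (c γ) (offset μ q z))
            where
            lemma : ∀ p q a b c o → p * (a - o * c) - q * b ≡ (p * a - q * b) - (p * o) * c
            lemma = solve-∀

          -- Replacing `γ` by its reflection permutes `R`, flips the sign of `c` and subtracts
          -- `c γ * d ρ` from `d γ`. Consequently `B + B` equals `d ρ * N`: the invariant form
          -- paired with a coroot is a multiple of evaluation at the root. The summand with `+ 0`
          -- pads to the shape of `sumOver-linear`.
          B-invariant : B ≡ (- + 1) * B + d ρ * N + + 0 * N
          B-invariant = begin
            B
              ≡⟨ sumℤ-↭ (Perm.map⁺ (λ γ → d γ * c γ) (reflectRoot-↭ μ unique)) ⟨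
            sumℤ (List.map (λ γ → d γ * c γ) (List.map s R))
              ≡⟨ cong sumℤ (map-∘ R) ⟨
            sumOver R (λ γ → d (s γ) * c (s γ))
              ≡⟨ sumOver-linear R {k = λ γ → c γ * c γ} (- + 1) (d ρ) (+ 0) (λ γ →
                   trans (cong₂ _*_ (displacement-reflectRoot γ) (coroot-reflectRoot μ γ)) (lemma (d γ) (c γ) (d ρ))) ⟩
            (- + 1) * B + d ρ * N + + 0 * N ∎
            where
            open ≡-Reasoning
            lemma : ∀ x y r → (x - y * r) * - y ≡ (- + 1) * (x * y) + r * (y * y) + + 0 * (y * y)
            lemma = solve-∀

        -- The mixed term of the expanded square is evaluated by `B-invariant`. For positive `p` and
        -- `q` the subtracted product is positive exactly when `z / q` and `ones / p` lie strictly
        -- on opposite sides of the mirror.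
        potential-reflection : potential (reflection μ q z) ≡
          potential z - (C * (q * (p * level μ - ones · ρ))) * N
        potential-reflection = begin
          potential (reflection μ q z)
            ≡⟨ sumOver-linear R (+ 1) (- (C * + 2)) (C * C) (λ γ →
                 trans (cong (λ t → t * t) (displacement-reflection γ)) (lemma₁ (d γ) (c γ) C)) ⟩
          + 1 * potential z + - (C * + 2) * B + (C * C) * N
            ≡⟨ lemma₂ (potential z) C B N ⟩
          potential z - C * (B + B) + (C * C) * N
            ≡⟨ cong (λ t → potential z - C * t + (C * C) * N) (trans (cong (_+_ B) B-invariant) (lemma₃ B (d ρ) N)) ⟩
          potential z - C * (d ρ * N) + (C * C) * N
            ≡⟨ lemma₄ (potential z) p q (z · ρ) (ones · ρ) (level μ) N ⟩
          potential z - (C * (q * (p * level μ - ones · ρ))) * N ∎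
          where
          open ≡-Reasoning
          lemma₁ : ∀ x y C → (x - C * y) * (x - C * y) ≡ + 1 * (x * x) + - (C * + 2) * (x * y) + (C * C) * (y * y)
          lemma₁ = solve-∀
          lemma₂ : ∀ P C B N → + 1 * P + - (C * + 2) * B + (C * C) * N ≡ P - C * (B + B) + (C * C) * N
          lemma₂ = solve-∀
          lemma₃ : ∀ B r N → B + ((- + 1) * B + r * N + + 0 * N) ≡ r * N
          lemma₃ = solve-∀
          lemma₄ : ∀ P p q a b k N →
            P - (p * (a - k * q)) * ((p * a - q * b) * N) + ((p * (a - k * q)) * (p * (a - k * q))) * N ≡
            P - ((p * (a - k * q)) * (q * (p * k - b))) * N
          lemma₄ = solve-∀

        potential-decreases : + 0 < C * (q * (p * level μ - ones · ρ)) →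
                              ∣ potential (reflection μ q z) ∣ ℕ.< ∣ potential z ∣
        potential-decreases pos = ∣∣-mono-< (potential-nonneg (reflection μ q z))
          (subst (_< potential z) (sym potential-reflection) (i-j<i (potential z) (*-pos pos N>0)))
          where
          N>0 : + 0 < N
          -- The root of the mirror itself contributes `2 * 2` to `N`.
          N>0 = sumOver-positive {f = λ γ → c γ * c γ} (λ γ → 0≤x*x (c γ)) (root∈R μ)
                  (subst (λ t → + 0 < t * t) (sym (pairing μ)) (ℤ.+<+ (ℕ.s≤s ℕ.z≤n)))

  -- The coweight z has coordinates z_i = (z, α_i); InAlcove θ q is q times the open fundamental alcove.
  record InAlcove {m} (θ : Vec ℤ m) (q : ℤ) (z : Vec ℤ m) : Set where
    constructor _▸_
    field
      positive : Positive z
      below    : z · θ < q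

  basis-nonneg : ∀ {m} (i : Fin m) → Nonneg (basis i)
  basis-nonneg i = lookup⁻ entry
    where
    entry : ∀ j → + 0 ≤ lookup (basis i) j
    entry j with i Fin.≟ j
    ... | yes refl = subst (+ 0 ≤_) (sym (lookup-basis-≡ i)) (ℤ.+≤+ ℕ.z≤n)
    ... | no i≢j   = ℤₚ.≤-reflexive (sym (lookup-basis-≢ i≢j))

  -- Coroots, the fundamental alcove, and folding into it.

  module _ {m : ℕ} {G : Gram m} {R : List (Vec ℤ m)} (system : IsIrredRootSystem m G R) where
    open IsIrredRootSystem system

    module _ {β : Vec ℤ m} (β∈R : β ∈ R) where

      private
        F = form G β β
        -- The coroot as a coweight: its coordinates are the Cartan integers `2 (αᵢ, β) / (β, β)`,
        -- which `reflect` supplies without division.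
        c = tabulate (λ i → proj₁ (reflect β (basis i) β∈R (simpleRoots i)))

        instance
          F≢0 : ℤ.NonZero F
          F≢0 = ℤ.>-nonZero (posDef β λ β≡0 → nonzero (subst (_∈ R) β≡0 β∈R))

        coroot-form : ∀ γ → (c · γ) * F ≡ + 2 * form G γ β
        coroot-form γ = trans (cong (_* F) (·-comm c γ))
          (·-proportional γ c (Vec.map (_· β) G) F (+ 2) entry)
          where
          entry : ∀ i → lookup c i * F ≡ + 2 * lookup (Vec.map (_· β) G) i
          entry i = begin
            lookup c i * F                               ≡⟨ cong (_* F) (lookup∘tabulate _ i) ⟩
            proj₁ r * F                                  ≡⟨ proj₁ (proj₂ r) ⟩
            + 2 * form G (basis i) β                     ≡⟨ cong (_*_ (+ 2)) (basis-· i (Vec.map (_· β) G)) ⟩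
            + 2 * lookup (Vec.map (_· β) G) i            ∎
            where
            open ≡-Reasoning
            r = reflect β (basis i) β∈R (simpleRoots i)

      mirror : ℤ → Mirror R
      mirror k .root    = β
      mirror k .coroot  = c
      mirror k .level   = k
      mirror k .root∈R  = β∈R
      mirror k .pairing = ℤₚ.*-cancelʳ-≡ (c · β) (+ 2) F (coroot-form β)
      -- `reflect` returns its own integer for `γ`; cancelling `F` identifies it with `c · γ`.
      mirror k .closed {γ} γ∈R with j , eq , mem ← reflect β γ β∈R γ∈R =
        subst (λ t → γ ⊖ (t • β) ∈ R) (ℤₚ.*-cancelʳ-≡ j (c · γ) F (trans eq (sym (coroot-form γ)))) mem

      -- This is `-β`, written as the reflection of `β` in its own mirror so that membership in `R`
      -- comes from closure.
      negated : Vec ℤ m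
      negated = reflectRoot (mirror (+ 0)) β

      negated∈R : negated ∈ R
      negated∈R = closed (mirror (+ 0)) β∈R

      private
        lemma : ∀ x → x - + 2 * x ≡ - x
        lemma = solve-∀

      ·-negated : ∀ z → z · negated ≡ - (z · β)
      ·-negated z = begin
        z · negated                 ≡⟨ ·-reflectʳ z β β (c · β) ⟩
        z · β - (c · β) * (z · β)   ≡⟨ cong (λ t → z · β - t * (z · β)) (pairing (mirror (+ 0))) ⟩
        z · β - + 2 * (z · β)       ≡⟨ lemma (z · β) ⟩
        - (z · β)                   ∎
        where open ≡-Reasoning

      lookup-negated : ∀ i → lookup negated i ≡ - lookup β i
      lookup-negated i = begin
        lookup negated i                    ≡⟨ lookup-⊖• β β (c · β) i ⟩
        lookup β i - (c · β) * lookup β i   ≡⟨ cong (λ t → lookup β i - t * lookup β i) (pairing (mirror (+ 0))) ⟩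
        lookup β i - + 2 * lookup β i       ≡⟨ lemma (lookup β i) ⟩
        - lookup β i                        ∎
        where open ≡-Reasoning

      negated-nonneg : Nonpos β → Nonneg negated
      negated-nonneg β≤0 = lookup⁻ λ i → subst (+ 0 ≤_) (sym (lookup-negated i)) (ℤₚ.neg-mono-≤ (lookup⁺ β≤0 i))

    module _ {θ : Vec ℤ m} (highest : IsHighestRoot R θ) where

      highest∈R : θ ∈ R
      highest∈R = proj₁ (∈-filter⁻ nonneg? {xs = R} (proj₁ highest))

      highest-maximal : ∀ {γ} → γ ∈ R → Nonneg γ → ∀ i → lookup γ i ≤ lookup θ i
      highest-maximal {γ} γ∈R γ≥0 = proj₂ highest γ (∈-filter⁺ nonneg? γ∈R γ≥0)

      highest-positive : Positive θ
      highest-positive i = ℤₚ.<-≤-trans (subst (+ 0 <_) (sym (lookup-basis-≡ i)) (ℤ.+<+ (ℕ.s≤s ℕ.z≤n)))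
                                        (highest-maximal (simpleRoots i) (basis-nonneg i) i)

      -- The highest root dominates: `0 < z · γ ≤ z · θ < q`. Thus `m + 1` inequalities locate `z`
      -- relative to all the hyperplanes.
      inAlcove-between : ∀ {q z γ} → InAlcove θ q z → γ ∈ R → Nonneg γ → Between (+ 0) q (z · γ)
      inAlcove-between {q} {z} {γ} (z>0 ▸ z·θ<q) γ∈R γ≥0 with positive-· {z = z} z>0 γ≥0
      ... | inj₁ γ≡0 = contradiction (subst (_∈ R) γ≡0 γ∈R) nonzero
      ... | inj₂ 0<z·γ = 0<z·γ ≪ subst (z · γ <_) (sym (ℤₚ.*-identityˡ q))
              (ℤₚ.≤-<-trans (·-monoʳ-≤ {z = z} z>0 (highest-maximal γ∈R γ≥0)) z·θ<q)

      inAlcove⇒same : ∀ {q z p y} → InAlcove θ q z → InAlcove θ p y → SameAlcove R q z p y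
      inAlcove⇒same {q} {z} {p} {y} az ay {γ} γ∈R with signed γ γ∈R
      ... | inj₁ γ≥0 = + 0 , inAlcove-between az γ∈R γ≥0 , inAlcove-between ay γ∈R γ≥0
      ... | inj₂ γ≤0 = - (+ 1) , negative az , negative ay
        where
        negative : ∀ {q z} → InAlcove θ q z → Between (- (+ 1)) q (z · γ)
        negative {q} {z} a = subst (Between (- (+ 1)) q)
          (trans (cong -_ (·-negated γ∈R z)) (ℤₚ.neg-involutive (z · γ)))
          (between-neg (inAlcove-between a (negated∈R γ∈R) (negated-nonneg γ∈R γ≤0)))

      -- The simple roots and `θ` are themselves roots, and their cells at `y` are the zeroth ones.
      inAlcove-resp-same : ∀ {q z p y} → + 0 < p → SameAlcove R q z p y → InAlcove θ p y → InAlcove θ q z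
      inAlcove-resp-same {q} {z} {p} {y} 0<p same ay = z>0 ▸ z·θ<q
        where
        cell : ∀ {γ} → γ ∈ R → Nonneg γ → Between (+ 0) q (z · γ)
        cell {γ} γ∈R γ≥0 with k , b , b′ ← same γ∈R =
          subst (λ k → Between k q (z · γ)) (between-unique 0<p b′ (inAlcove-between ay γ∈R γ≥0)) b
        z>0 : Positive z
        z>0 i = subst (+ 0 <_) (·-basis z i) (Between.lower (cell (simpleRoots i) (basis-nonneg i)))
        z·θ<q : z · θ < q
        z·θ<q = subst (z · θ <_) (ℤₚ.*-identityˡ q)
          (Between.upper (cell highest∈R (proj₂ (∈-filter⁻ nonneg? {xs = R} (proj₁ highest)))))

      h : ℤ
      h = + 1 + ones · θ

      0<h : + 0 < h
      0<h with positive-· {z = ones} ones-positive (lookup⁻ (ℤₚ.<⇒≤ ∘ highest-positive))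
      ... | inj₁ θ≡0 = contradiction (subst (_∈ R) θ≡0 highest∈R) nonzero
      ... | inj₂ lt  = ℤₚ.+-mono-< (ℤ.+<+ {0} {1} (ℕ.s≤s ℕ.z≤n)) lt

      ones-inAlcove : InAlcove θ h ones
      ones-inAlcove = ones-positive ▸ subst (_< h) (ℤₚ.+-identityˡ _) (ℤₚ.+-monoˡ-< (ones · θ) (ℤ.+<+ {0} {1} (ℕ.s≤s ℕ.z≤n)))

      -- Any other positive integer vector pairs with `θ` to strictly more than `ones · θ`, hence to
      -- at least `h`.
      inAlcove-h : ∀ {z} → InAlcove θ h z → z ≡ ones
      inAlcove-h {z} (z>0 ▸ lt) with ones-minimal {z = z} {θ} z>0 highest-positive
      ... | inj₁ eq  = eq
      ... | inj₂ lt′ = contradiction (ℤₚ.i<j⇒suc[i]≤j lt′) (ℤₚ.<⇒≱ lt)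

      -- The factor multiplying `N` in `potential-reflection` at `p = h`.
      Separates : ℤ → Vec ℤ m → Mirror R → Set
      Separates q z μ = + 0 < (h * offset μ q z) * (q * (h * level μ - ones · root μ))

      -- Genericity excludes a vanishing coordinate, so both factors are strictly negative: `z` lies
      -- behind the wall and `ones` in front of it.
      simple-separates : ∀ {q z} i → + 0 < q → Generic R q z → lookup z i ≤ + 0 →
                         Separates q z (mirror (simpleRoots i) (+ 0))
      simple-separates {q} {z} i 0<q gen zᵢ≤0 = *-pos-neg
        (subst (+ 0 <_) (lemma₁ h (z · basis i) q) (*-pos 0<h (ℤₚ.neg-mono-< zᵢ<0)))
        (subst (+ 0 <_) (trans (lemma₂ q h) (cong (λ t → - (q * (h * + 0 - t))) (sym (trans (·-basis ones i) (lookup-ones i))))) 0<q)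
        where
        zᵢ<0 : z · basis i < + 0
        zᵢ<0 = ℤₚ.≤∧≢⇒< (subst (_≤ + 0) (sym (·-basis z i)) zᵢ≤0)
                 (λ eq → gen (simpleRoots i) (divides (+ 0) eq))
        lemma₁ : ∀ h x q → h * - x ≡ - (h * (x - + 0 * q))
        lemma₁ = solve-∀
        lemma₂ : ∀ q h → q ≡ - (q * (h * + 0 - + 1))
        lemma₂ = solve-∀

      highest-separates : ∀ {q z} → + 0 < q → Generic R q z → q ≤ z · θ → Separates q z (mirror highest∈R (+ 1))
      highest-separates {q} {z} 0<q gen q≤z·θ =
        *-pos (*-pos 0<h (i<j⇒0<j-i (subst (_< z · θ) (sym (ℤₚ.*-identityˡ q)) q<z·θ)))
              -- As `h` exceeds `ones · θ` by one, the second factor is just `q`.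
              (subst (+ 0 <_) (lemma q (ones · θ)) 0<q)
        where
        q<z·θ : q < z · θ
        q<z·θ = ℤₚ.≤∧≢⇒< q≤z·θ
                  (λ eq → gen highest∈R (divides (+ 1) (trans (sym eq) (sym (ℤₚ.*-identityˡ q)))))
        lemma : ∀ q t → q ≡ q * ((+ 1 + t) * + 1 - t)
        lemma = solve-∀

      inAlcove⊎separates : ∀ q z → + 0 < q → Generic R q z → InAlcove θ q z ⊎ Σ (Mirror R) (Separates q z)
      inAlcove⊎separates q z 0<q gen with any? (λ i → lookup z i ℤ.≤? + 0) | z · θ ℤ.<? q
      ... | yes (i , zᵢ≤0) | _         = inj₂ (mirror (simpleRoots i) (+ 0) , simple-separates {q} {z} i 0<q gen zᵢ≤0)
      ... | no z≰0         | yes z·θ<q = inj₁ ((λ i → ℤₚ.≰⇒> λ zᵢ≤0 → z≰0 (i , zᵢ≤0)) ▸ z·θ<q)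
      ... | no z≰0         | no z·θ≮q  = inj₂ (mirror highest∈R (+ 1) , highest-separates {q} {z} 0<q gen (ℤₚ.≮⇒≥ z·θ≮q))

      -- Reflecting in a wall that separates z / q from ones / h brings z / q closer to ones / h.
      fold : ∀ {q z} → + 0 < q → Generic R q z → Acc ℕ._<_ ∣ potential {R = R} h q z ∣ →
             InAlcove θ q z ⊎ Σ (Mirror R) (Separates q z) → Σ (Word R) λ w → InAlcove θ q (act q w z)
      fold 0<q gen _ (inj₁ a) = [] , a
      fold {q} {z} 0<q gen (acc rec) (inj₂ (μ , sep)) =
        let gen′  = reflection-generic μ {q} {z} gen
            w , a = fold {q} {reflection μ q z} 0<q gen′ (rec (potential-decreases h q unique μ z sep))
                      (inAlcove⊎separates q (reflection μ q z) 0<q gen′)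
        in μ ∷ w , a

      foldWord : ∀ q z → + 0 < q → Generic R q z → Σ (Word R) λ w → InAlcove θ q (act q w z)
      foldWord q z 0<q gen = fold {q} {z} 0<q gen (<-wellFounded _) (inAlcove⊎separates q z 0<q gen)

  -- Duplicate-free enumerations of the good points and of the points of a dilated alcove.

  concatMap-unique : ∀ {A B : Set} {f : A → List B} {xs} → Unique xs → (∀ x → Unique (f x)) →
                     (∀ {x y v} → v ∈ f x → v ∈ f y → x ≡ y) → Unique (concatMap f xs)
  concatMap-unique [] u disj = []
  concatMap-unique {f = f} {x ∷ xs} (x∉ ∷ xs!) u disj = Unique.++⁺ (u x) (concatMap-unique xs! u disj)
    λ (v∈fx , v∈) → let y , y∈ , v∈fy = find (∈-concatMap⁻ f {xs = xs} v∈) in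
                    LAll.lookup x∉ y∈ (disj v∈fx v∈fy)

  map-unique-on : ∀ {A B : Set} {f : A → B} {xs} → (∀ {x y} → x ∈ xs → y ∈ xs → f x ≡ f y → x ≡ y) →
                  Unique xs → Unique (List.map f xs)
  map-unique-on inj [] = []
  map-unique-on {f = f} inj (x∉ ∷ xs!) =
    LAll.map⁺ (LAll.tabulate λ y∈ eq → LAll.lookup x∉ y∈ (inj (here refl) (there y∈) eq)) ∷
    map-unique-on (λ x∈ y∈ → inj (there x∈) (there y∈)) xs!

  length-cartesianProduct : ∀ {A B : Set} (xs : List A) (ys : List B) →
                            length (cartesianProduct xs ys) ≡ length xs ℕ.* length ys
  length-cartesianProduct []       ys = refl
  length-cartesianProduct (x ∷ xs) ys =
    trans (length-++ (List.map (x ,_) ys)) (cong₂ ℕ._+_ (length-map (x ,_) ys) (length-cartesianProduct xs ys))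

  allVecs-unique : ∀ m q → Unique (allVecs m q)
  allVecs-unique zero    q = LAll.[] ∷ []
  allVecs-unique (suc m) q = concatMap-unique (Unique.allFin⁺ q)
    (λ i → Unique.map⁺ (proj₂ ∘ ∷-injective) (allVecs-unique m q)) disjoint
    where
    disjoint : ∀ {i j v} → v ∈ List.map (i ∷_) (allVecs m q) → v ∈ List.map (j ∷_) (allVecs m q) → i ≡ j
    disjoint {i} {j} v∈ v∈′ with _ , _ , refl ← ∈-map⁻ (i ∷_) v∈ | _ , _ , refl ← ∈-map⁻ (j ∷_) v∈′ = refl

  ∈-allVecs : ∀ {m q} (v : Vec (Fin q) m) → v ∈ allVecs m q
  ∈-allVecs []      = here refl
  ∈-allVecs (i ∷ v) = ∈-concatMap⁺ (λ i → List.map (i ∷_) (allVecs _ _)) (lose (∈-allFin i) (∈-map⁺ (i ∷_) (∈-allVecs v)))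

  Box : ∀ {m} → ℤ → Vec ℤ m → Set
  Box q z = ∀ i → + 0 ≤ lookup z i × lookup z i < q

  toℤvec-injective : ∀ {m q} {u v : Vec (Fin q) m} → toℤvec u ≡ toℤvec v → u ≡ v
  toℤvec-injective {u = []}    {[]}    eq = refl
  toℤvec-injective {u = i ∷ u} {j ∷ v} eq with p , eq′ ← ∷-injective eq =
    cong₂ _∷_ (toℕ-injective (ℤₚ.+-injective p)) (toℤvec-injective eq′)

  toℤvec-box : ∀ {m q} (v : Vec (Fin q) m) → Box (+ q) (toℤvec v)
  toℤvec-box v i = subst (λ x → + 0 ≤ x × x < + _) (sym (lookup-map i (λ i → + toℕ i) v))
                     (ℤ.+≤+ ℕ.z≤n , ℤ.+<+ (toℕ<n (lookup v i)))

  box-toℤvec : ∀ {m q} {z : Vec ℤ m} → Box (+ q) z → Σ (Vec (Fin q) m) λ v → toℤvec v ≡ z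
  box-toℤvec {z = []} box = [] , refl
  box-toℤvec {z = x ∷ z} box with x | box Fin.zero | box-toℤvec {z = z} (box ∘ Fin.suc)
  ... | + k | _ , ℤ.+<+ k<q | v , refl = fromℕ< k<q ∷ v , cong (λ k → + k ∷ toℤvec v) (toℕ-fromℕ< k<q)

  goodPoints : ∀ {m} → List (Vec ℤ m) → ℕ → List (Vec ℤ m)
  goodPoints {m} R q = List.map toℤvec (filter (good? q R) (allVecs m q))

  goodPoints-unique : ∀ {m} (R : List (Vec ℤ m)) q → Unique (goodPoints R q)
  goodPoints-unique {m} R q = Unique.map⁺ toℤvec-injective (Unique.filter⁺ (good? q R) (allVecs-unique m q))

  ∈-goodPoints⁺ : ∀ {m} {R : List (Vec ℤ m)} {q z} → Box (+ q) z → Generic R (+ q) z → z ∈ goodPoints R q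
  ∈-goodPoints⁺ {R = R} {q} {z} box gen with v , refl ← box-toℤvec {z = z} box =
    ∈-map⁺ toℤvec (∈-filter⁺ (good? q R) (∈-allVecs v)
      (LAll.tabulate λ {γ} γ∈ q∣ → gen (proj₁ (∈-filter⁻ nonneg? {xs = R} γ∈)) (ℤᵈ.∣ᵤ⇒∣ {+ q} {toℤvec v · γ} q∣)))

  -- Choosing `suc j` as head coordinate leaves the budget `q ∸ suc j * n`. A zero budget admits no
  -- point, not even the empty vector; this encodes the strict inequality and makes truncated
  -- subtraction harmless.
  alcovePoints : ∀ {m} → Vec ℕ m → ℕ → List (Vec ℤ m)
  alcovePoints []       zero    = []
  alcovePoints []       (suc q) = [] ∷ []
  alcovePoints (n ∷ ns) q       =
    concatMap (λ j → List.map (+ suc j ∷_) (alcovePoints ns (q ℕ.∸ suc j ℕ.* n))) (upTo q)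

  alcovePoints-unique : ∀ {m} (ns : Vec ℕ m) q → Unique (alcovePoints ns q)
  alcovePoints-unique []       zero    = []
  alcovePoints-unique []       (suc q) = LAll.[] ∷ []
  alcovePoints-unique (n ∷ ns) q = concatMap-unique (Unique.upTo⁺ q)
    (λ j → Unique.map⁺ (proj₂ ∘ ∷-injective) (alcovePoints-unique ns _)) disjoint
    where
    disjoint : ∀ {i j v} → v ∈ List.map (+ suc i ∷_) (alcovePoints ns (q ℕ.∸ suc i ℕ.* n)) →
               v ∈ List.map (+ suc j ∷_) (alcovePoints ns (q ℕ.∸ suc j ℕ.* n)) → i ≡ j
    disjoint {i} {j} v∈ v∈′ with _ , _ , refl ← ∈-map⁻ (+ suc i ∷_) v∈ | _ , _ , refl ← ∈-map⁻ (+ suc j ∷_) v∈′ = refl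

  ·-nonneg : ∀ {m} {z : Vec ℤ m} (ns : Vec ℕ m) → Positive z → + 0 ≤ z · Vec.map +_ ns
  ·-nonneg {z = []}    []       z>0 = ℤₚ.≤-refl
  ·-nonneg {z = x ∷ z} (n ∷ ns) z>0 with x | z>0 Fin.zero
  ... | + k | _ = ℤₚ.+-mono-≤ (subst (+ 0 ≤_) (ℤₚ.pos-* k n) (ℤ.+≤+ ℕ.z≤n)) (·-nonneg {z = z} ns (z>0 ∘ Fin.suc))

  <-∸⁻ : ∀ {x} a q → + 0 ≤ x → x < + (q ℕ.∸ a) → + a + x < + q
  <-∸⁻ {+ k} a q _ (ℤ.+<+ lt) = ℤ.+<+ (subst (ℕ._≤ q) (trans (ℕₚ.+-comm (suc k) a) (ℕₚ.+-suc a k))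
    (ℕₚ.m≤o∸n⇒m+n≤o (suc k) (ℕₚ.<⇒≤ (ℕₚ.m∸n≢0⇒n<m (λ eq → ℕₚ.n≮0 (subst (k ℕ.<_) eq lt)))) lt))

  <-∸⁺ : ∀ {x} a q → + 0 ≤ x → + a + x < + q → x < + (q ℕ.∸ a)
  <-∸⁺ {+ k} a q _ (ℤ.+<+ lt) = ℤ.+<+ (ℕₚ.m+n≤o⇒m≤o∸n (suc k) (subst (ℕ._≤ q) (cong suc (ℕₚ.+-comm a k)) lt))

  ∈-alcovePoints⁻ : ∀ {m} (ns : Vec ℕ m) {q z} → z ∈ alcovePoints ns q → InAlcove (Vec.map +_ ns) (+ q) z
  ∈-alcovePoints⁻ [] {suc q} (here refl) = (λ ()) ▸ ℤ.+<+ (ℕ.s≤s ℕ.z≤n)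
  ∈-alcovePoints⁻ (n ∷ ns) {q} z∈
    with j , _ , z∈′ ← find (∈-concatMap⁻ (λ j → List.map (+ suc j ∷_) (alcovePoints ns (q ℕ.∸ suc j ℕ.* n))) {xs = upTo q} z∈)
    with z , z∈″ , refl ← ∈-map⁻ (+ suc j ∷_) z∈′
    with z>0 ▸ lt ← ∈-alcovePoints⁻ ns z∈″ =
    (λ { Fin.zero → ℤ.+<+ (ℕ.s≤s ℕ.z≤n) ; (Fin.suc i) → z>0 i }) ▸
    subst (λ t → t + z · Vec.map +_ ns < + q) (ℤₚ.pos-* (suc j) n) (<-∸⁻ (suc j ℕ.* n) q (·-nonneg {z = z} ns z>0) lt)

  ∈-alcovePoints⁺ : ∀ {m} (ns : Vec ℕ m) {q z} → Positive (Vec.map +_ ns) → InAlcove (Vec.map +_ ns) (+ q) z →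
                    z ∈ alcovePoints ns q
  ∈-alcovePoints⁺ [] {suc q} {[]} ns>0 _ = here refl
  ∈-alcovePoints⁺ [] {zero} {[]} ns>0 (_ ▸ ℤ.+<+ ())
  ∈-alcovePoints⁺ (n ∷ ns) {q} {x ∷ z} ns>0 (z>0 ▸ lt) with x | z>0 Fin.zero | ns>0 Fin.zero
  ... | + zero  | ℤ.+<+ () | _
  ... | + suc j | _ | ℤ.+<+ 0<n = ∈-concatMap⁺ (λ j → List.map (+ suc j ∷_) (alcovePoints ns (q ℕ.∸ suc j ℕ.* n)))
          (lose (∈-upTo⁺ j<q) (∈-map⁺ (+ suc j ∷_) (∈-alcovePoints⁺ ns (ns>0 ∘ Fin.suc) ((z>0 ∘ Fin.suc) ▸ lt″))))
    where
    z≥0 = ·-nonneg {z = z} ns (z>0 ∘ Fin.suc)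
    lt′ : + (suc j ℕ.* n) + z · Vec.map +_ ns < + q
    lt′ = subst (λ t → t + z · Vec.map +_ ns < + q) (sym (ℤₚ.pos-* (suc j) n)) lt
    lt″ = <-∸⁺ (suc j ℕ.* n) q z≥0 lt′
    j<q : j ℕ.< q
    j<q = ℕₚ.≤-trans (ℕₚ.m≤m*n (suc j) n {{ℕ.>-nonZero 0<n}})
            (ℕₚ.<⇒≤ (ℤₚ.drop‿+<+ (ℤₚ.≤-<-trans (subst (_≤ + (suc j ℕ.* n) + z · Vec.map +_ ns)
              (ℤₚ.+-identityʳ (+ (suc j ℕ.* n))) (ℤₚ.+-monoʳ-≤ (+ (suc j ℕ.* n)) z≥0)) lt′)))

  -- The bijection between good points and pairs of an alcove and a point in it.

  module _ {m : ℕ} {G : Gram m} {R : List (Vec ℤ m)} (system : IsIrredRootSystem m G R) where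
    open IsIrredRootSystem system

    -- `Good` tests positive roots only; a negative root is reached through its negation,
    -- divisibility being blind to sign.
    ∈-goodPoints⁻ : ∀ {q z} → z ∈ goodPoints R q → Box (+ q) z × Generic R (+ q) z
    ∈-goodPoints⁻ {q} z∈ with v , v∈ , refl ← ∈-map⁻ toℤvec z∈ = toℤvec-box v , generic
      where
      positive : ∀ {γ} → γ ∈ R → Nonneg γ → ¬ + q ∣ toℤvec v · γ
      positive γ∈R γ≥0 q∣ =
        LAll.lookup (proj₂ (∈-filter⁻ (good? q R) {xs = allVecs m q} v∈)) (∈-filter⁺ nonneg? γ∈R γ≥0) (ℤᵈ.∣⇒∣ᵤ q∣)
      generic : Generic R (+ q) (toℤvec v)
      generic {γ} γ∈R q∣ with signed γ γ∈R
      ... | inj₁ γ≥0 = positive γ∈R γ≥0 q∣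
      ... | inj₂ γ≤0 = positive (negated∈R system γ∈R) (negated-nonneg system γ∈R γ≤0)
              (subst (+ q ∣_) (sym (·-negated system γ∈R (toℤvec v))) (ℤᵈ.∣m⇒∣-m q∣))

    -- The simple roots belong to `R`, so the cells fix the integer part of every coordinate divided
    -- by the scale: no alcove straddles the boundary of the box.
    box-resp-same : ∀ {q z p y} → + 0 < p → SameAlcove R q z p y → Box p y → Box q z
    box-resp-same {q} {z} {p} {y} 0<p same box i with k , b , l ≪ u ← same (simpleRoots i)
      with yᵢ≥0 , yᵢ<p ← subst (λ t → + 0 ≤ t × t < p) (sym (·-basis y i)) (box i) =
      subst (λ t → + 0 ≤ t × t < q) (·-basis z i)
        (ℤₚ.<⇒≤ (Between.lower b₀) , subst (z · basis i <_) (ℤₚ.*-identityˡ q) (Between.upper b₀))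
      where
      k≡0 : k ≡ + 0
      k≡0 = ℤₚ.≤-antisym (between-≤ 0<p (ℤₚ.<⇒≤ l) (subst (y · basis i <_) (sym (ℤₚ.*-identityˡ p)) yᵢ<p))
                         (between-≤ 0<p yᵢ≥0 u)
      b₀ : Between (+ 0) q (z · basis i)
      b₀ = subst (λ k → Between k q (z · basis i)) k≡0 b

    module _ (ns : Vec ℕ m) (highest : IsHighestRoot R (Vec.map +_ ns)) (c : ℕ) (h≡c : h system highest ≡ + c) where

      private
        θ = Vec.map +_ ns

        0<c : + 0 < + c
        0<c = subst (+ 0 <_) h≡c (0<h system highest)

      -- Folding words are not unique, so one is fixed per `y`. The empty word is only a default
      -- value: good points are generic.
      wordOf : Vec ℤ m → Word R
      wordOf y with LAll.all? (λ γ → ¬? (+ c ℤᵈ.∣? y · γ)) R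
      ... | yes gen = proj₁ (foldWord system highest (+ c) y 0<c (LAll.lookup gen))
      ... | no  _   = []

      wordOf-ones : ∀ {y} → Generic R (+ c) y → act (+ c) (wordOf y) y ≡ ones
      wordOf-ones {y} gen with LAll.all? (λ γ → ¬? (+ c ℤᵈ.∣? y · γ)) R
      ... | yes gen′ = inAlcove-h system highest
              (subst (λ t → InAlcove θ t (act (+ c) (proj₁ f) y)) (sym h≡c) (proj₂ f))
        where f = foldWord system highest (+ c) y 0<c (LAll.lookup gen′)
      ... | no ¬gen = contradiction (LAll.tabulate (λ {γ} → gen {γ})) ¬gen

      ones-inAlcove′ : InAlcove θ (+ c) ones
      ones-inAlcove′ = subst (λ t → InAlcove θ t ones) h≡c (ones-inAlcove system highest)

      module _ (q : ℕ) (0<q : + 0 < + q) where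

        -- The copy of `z` in the alcove of `y / c`; the good points `y` at scale `c` serve as names
        -- of the alcoves in the box.
        place : Vec ℤ m × Vec ℤ m → Vec ℤ m
        place (y , z) = unact (+ q) (wordOf y) z

        place-same : ∀ {y z} → y ∈ goodPoints R c → z ∈ alcovePoints ns q → SameAlcove R (+ q) (place (y , z)) (+ c) y
        place-same {y} {z} y∈ z∈ = subst (SameAlcove R (+ q) (place (y , z)) (+ c))
          (trans (cong (unact (+ c) (wordOf y)) (sym (wordOf-ones {y} (proj₂ (∈-goodPoints⁻ y∈)))))
                 (unact-act (+ c) (wordOf y) y))
          (unact-same (wordOf y) (inAlcove⇒same system highest (∈-alcovePoints⁻ ns z∈) ones-inAlcove′))

        placed : List (Vec ℤ m)
        placed = List.map place (cartesianProduct (goodPoints R c) (alcovePoints ns q))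

        placed-unique : Unique placed
        placed-unique = map-unique-on injective
          (Unique.cartesianProduct⁺ (goodPoints-unique R c) (alcovePoints-unique ns q))
          where
          injective : ∀ {a b} → a ∈ cartesianProduct (goodPoints R c) (alcovePoints ns q) →
                      b ∈ cartesianProduct (goodPoints R c) (alcovePoints ns q) → place a ≡ place b → a ≡ b
          injective {y , z} {y′ , z′} a∈ b∈ eq
            with y∈ , z∈ ← ∈-cartesianProduct⁻ (goodPoints R c) (alcovePoints ns q) a∈
               | y′∈ , z′∈ ← ∈-cartesianProduct⁻ (goodPoints R c) (alcovePoints ns q) b∈ =
            cong₂ _,_ y≡y′ z≡z′
            where
            w = wordOf y
            -- The common image puts `y` and `y′` in one alcove, and at scale `c` an alcove holds a
            -- single lattice point.
            same : SameAlcove R (+ c) y′ (+ c) y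
            same = same-trans {q = + c} {y′} {+ q} {place (y , z)} {+ c} {y} 0<q
              (same-sym {q = + q} {place (y , z)} {+ c} {y′}
                (subst (λ x → SameAlcove R (+ q) x (+ c) y′) (sym eq) (place-same y′∈ z′∈))) (place-same y∈ z∈)
            at-ones : act (+ c) w y ≡ ones
            at-ones = wordOf-ones {y} (proj₂ (∈-goodPoints⁻ y∈))
            at-ones′ : act (+ c) w y′ ≡ ones
            at-ones′ = inAlcove-h system highest (subst (λ t → InAlcove θ t (act (+ c) w y′)) (sym h≡c)
              (inAlcove-resp-same system highest {+ c} {act (+ c) w y′} {+ c} {act (+ c) w y} 0<c
                (act-same w {+ c} {y′} {+ c} {y} same) (subst (InAlcove θ (+ c)) (sym at-ones) ones-inAlcove′)))
            y≡y′ : y ≡ y′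
            y≡y′ = begin
              y                              ≡⟨ unact-act (+ c) w y ⟨
              unact (+ c) w (act (+ c) w y)  ≡⟨ cong (unact (+ c) w) (trans at-ones (sym at-ones′)) ⟩
              unact (+ c) w (act (+ c) w y′) ≡⟨ unact-act (+ c) w y′ ⟩
              y′                             ∎
              where open ≡-Reasoning
            z≡z′ : z ≡ z′
            z≡z′ = begin
              z                                 ≡⟨ act-unact (+ q) w z ⟨
              act (+ q) w (unact (+ q) w z)     ≡⟨ cong (act (+ q) w) eq ⟩
              act (+ q) w (place (y′ , z′))     ≡⟨ cong (λ y → act (+ q) w (unact (+ q) (wordOf y) z′)) y≡y′ ⟨
              act (+ q) w (unact (+ q) w z′)    ≡⟨ act-unact (+ q) w z′ ⟩
              z′                                ∎
              where open ≡-Reasoning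

        placed⊆good : ∀ {x} → x ∈ placed → x ∈ goodPoints R q
        placed⊆good x∈ with (y , z) , yz∈ , refl ← ∈-map⁻ place x∈
          with y∈ , z∈ ← ∈-cartesianProduct⁻ (goodPoints R c) (alcovePoints ns q) yz∈ =
          ∈-goodPoints⁺ (box-resp-same {+ q} {place (y , z)} {+ c} {y} 0<c (place-same y∈ z∈) (proj₁ (∈-goodPoints⁻ y∈)))
                        (same⇒generic {q = + q} {place (y , z)} {+ c} {y} 0<q (place-same y∈ z∈))

        good⊆placed : ∀ {x} → x ∈ goodPoints R q → x ∈ placed
        good⊆placed {x} x∈ with box , gen ← ∈-goodPoints⁻ x∈
          with w , a ← foldWord system highest (+ q) x 0<q gen =
          subst (_∈ placed) (unact-act (+ q) (wordOf y) x)
            (∈-map⁺ place (∈-cartesianProduct⁺ y∈ (∈-alcovePoints⁺ ns (highest-positive system highest) a′)))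
          where
          -- The name of the alcove of `x`: the word folding `x`, undone on `ones` at scale `c`.
          y = unact (+ c) w ones
          same : SameAlcove R (+ q) x (+ c) y
          same = subst (λ x → SameAlcove R (+ q) x (+ c) y) (unact-act (+ q) w x)
            (unact-same w (inAlcove⇒same system highest a ones-inAlcove′))
          y-generic : Generic R (+ c) y
          y-generic = same⇒generic {q = + c} {y} {+ q} {x} 0<c (same-sym {q = + q} {x} {+ c} {y} same)
          y∈ : y ∈ goodPoints R c
          y∈ = ∈-goodPoints⁺ (box-resp-same {+ c} {y} {+ q} {x} 0<q (same-sym {q = + q} {x} {+ c} {y} same) box) y-generic
          -- `wordOf y` may differ from `w`, but it folds `y` to `ones`, and `x` shares the alcove
          -- of `y`.
          a′ : InAlcove θ (+ q) (act (+ q) (wordOf y) x)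
          a′ = inAlcove-resp-same system highest {+ q} {act (+ q) (wordOf y) x} {+ c} {act (+ c) (wordOf y) y} 0<c
            (act-same (wordOf y) {+ q} {x} {+ c} {y} same)
            (subst (InAlcove θ (+ c)) (sym (wordOf-ones {y} y-generic)) ones-inAlcove′)

        χ-factors : χ R q ≡ χ R c ℕ.* length (alcovePoints ns q)
        χ-factors = begin
          χ R q                                          ≡⟨ length-map toℤvec (filter (good? q R) (allVecs m q)) ⟨
          length (goodPoints R q)                        ≡⟨ Perm.↭-length (unique⇒↭ (goodPoints-unique R q) placed-unique good⊆placed placed⊆good) ⟩
          length placed                                  ≡⟨ length-map place (cartesianProduct (goodPoints R c) (alcovePoints ns q)) ⟩
          length (cartesianProduct (goodPoints R c) (alcovePoints ns q))
                                                         ≡⟨ length-cartesianProduct (goodPoints R c) (alcovePoints ns q) ⟩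
          length (goodPoints R c) ℕ.* length (alcovePoints ns q)
                                                         ≡⟨ cong (ℕ._* length (alcovePoints ns q)) (length-map toℤvec (filter (good? c R) (allVecs m c))) ⟩
          χ R c ℕ.* length (alcovePoints ns q)           ∎
          where open ≡-Reasoning

open AlcoveGeometry

-- Recursion and growth of the number of points in a dilated alcove.

module AlcoveCounting where
  open import Data.Nat using (_+_; _*_; _∸_; _^_; _≤_; _<_; z≤n; s≤s)
  open import Data.Nat.Tactic.RingSolver using (solve-∀)
  open import Data.Nat.Divisibility using (_∣_; _∣?_)

  sumUpTo : ℕ → (ℕ → ℕ) → ℕ
  sumUpTo zero    f = 0
  sumUpTo (suc k) f = f 0 + sumUpTo k (f ∘ suc)

  sumUpTo-cong : ∀ k {f g} → (∀ j → f j ≡ g j) → sumUpTo k f ≡ sumUpTo k g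
  sumUpTo-cong zero    eq = refl
  sumUpTo-cong (suc k) eq = cong₂ _+_ (eq 0) (sumUpTo-cong k (eq ∘ suc))

  sumUpTo-zero : ∀ k {f} → (∀ j → f j ≡ 0) → sumUpTo k f ≡ 0
  sumUpTo-zero zero    eq = refl
  sumUpTo-zero (suc k) eq = cong₂ _+_ (eq 0) (sumUpTo-zero k (eq ∘ suc))

  sumUpTo-truncate : ∀ k l {f} → (∀ j → k ≤ j → f j ≡ 0) → sumUpTo (k + l) f ≡ sumUpTo k f
  sumUpTo-truncate zero    l eq = sumUpTo-zero l (λ j → eq j z≤n)
  sumUpTo-truncate (suc k) l {f} eq = cong (_+_ (f 0)) (sumUpTo-truncate k l (λ j k≤j → eq (suc j) (s≤s k≤j)))

  length-concatMap-applyUpTo : ∀ {A : Set} (f : ℕ → List A) g k →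
                               length (concatMap f (applyUpTo g k)) ≡ sumUpTo k (length ∘ f ∘ g)
  length-concatMap-applyUpTo f g zero    = refl
  length-concatMap-applyUpTo f g (suc k) =
    trans (length-++ (f (g 0))) (cong (_+_ (length (f (g 0)))) (length-concatMap-applyUpTo f (g ∘ suc) k))

  alcoveCount : ∀ {m} → Vec ℕ m → ℕ → ℕ
  alcoveCount ns q = length (alcovePoints ns q)

  alcoveCount-∷ : ∀ {m} n (ns : Vec ℕ m) q →
                  alcoveCount (n ∷ ns) q ≡ sumUpTo q (λ j → alcoveCount ns (q ∸ suc j * n))
  alcoveCount-∷ n ns q = trans
    (length-concatMap-applyUpTo (λ j → List.map (+ suc j ∷_) (alcovePoints ns (q ∸ suc j * n))) id q)
    (sumUpTo-cong q (λ j → length-map (+ suc j ∷_) (alcovePoints ns (q ∸ suc j * n))))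

  alcoveCount-zero : ∀ {m} (ns : Vec ℕ m) → alcoveCount ns 0 ≡ 0
  alcoveCount-zero []       = refl
  alcoveCount-zero (n ∷ ns) = refl

  alcoveCount-small : ∀ {m} n (ns : Vec ℕ m) {q} → q ≤ n → alcoveCount (n ∷ ns) q ≡ 0
  alcoveCount-small n ns {q} q≤n = trans (alcoveCount-∷ n ns q) (sumUpTo-zero q λ j →
    trans (cong (alcoveCount ns) (ℕₚ.m≤n⇒m∸n≡0 (ℕₚ.≤-trans q≤n (ℕₚ.m≤m+n n (j * n))))) (alcoveCount-zero ns))

  -- The solutions z of z₁ n + … < n + q split into those with z₁ = 1 and those with z₁ ≥ 2.
  alcoveCount-+ : ∀ {m} n (ns : Vec ℕ m) q → 0 < n →
                  alcoveCount (n ∷ ns) (n + q) ≡ alcoveCount ns q + alcoveCount (n ∷ ns) q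
  alcoveCount-+ n@(suc n′) ns q _ = begin
    alcoveCount (n ∷ ns) (n + q)
      ≡⟨ alcoveCount-∷ n ns (n + q) ⟩
    alcoveCount ns (n + q ∸ 1 * n) + sumUpTo (n′ + q) (λ j → alcoveCount ns (n + q ∸ suc (suc j) * n))
      ≡⟨ cong₂ _+_ (cong (alcoveCount ns) (trans (cong (n + q ∸_) (ℕₚ.*-identityˡ n)) (ℕₚ.m+n∸m≡n n q)))
                   (sumUpTo-cong (n′ + q) (λ j → cong (alcoveCount ns) (ℕₚ.[m+n]∸[m+o]≡n∸o n q (suc j * n)))) ⟩
    alcoveCount ns q + sumUpTo (n′ + q) f
      ≡⟨ cong (λ k → alcoveCount ns q + sumUpTo k f) (ℕₚ.+-comm n′ q) ⟩
    alcoveCount ns q + sumUpTo (q + n′) f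
      ≡⟨ cong (_+_ (alcoveCount ns q)) (sumUpTo-truncate q n′ f-zero) ⟩
    alcoveCount ns q + sumUpTo q f
      ≡⟨ cong (_+_ (alcoveCount ns q)) (alcoveCount-∷ n ns q) ⟨
    alcoveCount ns q + alcoveCount (n ∷ ns) q ∎
    where
    open ≡-Reasoning
    f : ℕ → ℕ
    f j = alcoveCount ns (q ∸ suc j * n)
    f-zero : ∀ j → q ≤ j → f j ≡ 0
    f-zero j q≤j = trans
      (cong (alcoveCount ns) (ℕₚ.m≤n⇒m∸n≡0 (ℕₚ.≤-trans q≤j (ℕₚ.≤-trans (ℕₚ.n≤1+n j) (ℕₚ.m≤m*n (suc j) n)))))
      (alcoveCount-zero ns)

  -- The tangent bound at the lower endpoint `r`.
  n*^≤^-difference : ∀ n r m → r ^ suc m + suc m * n * r ^ m ≤ (n + r) ^ suc m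
  n*^≤^-difference n r zero    = ℕₚ.≤-reflexive (lemma n r)
    where
    lemma : ∀ n r → r * 1 + 1 * n * 1 ≡ (n + r) * 1
    lemma = solve-∀
  n*^≤^-difference n r (suc m) = begin
    r * (r * r ^ m) + suc (suc m) * n * (r * r ^ m)
      ≤⟨ ℕₚ.m≤m+n _ _ ⟩
    r * (r * r ^ m) + suc (suc m) * n * (r * r ^ m) + n * (suc m * n * r ^ m)
      ≡⟨ lemma n r m (r ^ m) ⟩
    (n + r) * (r * r ^ m + suc m * n * r ^ m)
      ≤⟨ ℕₚ.*-monoʳ-≤ (n + r) (n*^≤^-difference n r m) ⟩
    (n + r) * (n + r) ^ suc m ∎
    where
    open ℕₚ.≤-Reasoning
    lemma : ∀ n r m p → r * (r * p) + suc (suc m) * n * (r * p) + n * (suc m * n * p) ≡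
                        (n + r) * (r * p + suc m * n * p)
    lemma = solve-∀

  -- The companion bound at the upper endpoint: together they enclose the increment of a power as
  -- the mean value theorem would.
  ^-difference≤n*^ : ∀ n w m → (n + w) ^ suc m ≤ w ^ suc m + suc m * n * (n + w) ^ m
  ^-difference≤n*^ n w zero    = ℕₚ.≤-reflexive (lemma n w)
    where
    lemma : ∀ n w → (n + w) * 1 ≡ w * 1 + 1 * n * 1
    lemma = solve-∀
  ^-difference≤n*^ n w (suc m) = begin
    (n + w) * (n + w) ^ suc m
      ≡⟨ ℕₚ.*-distribʳ-+ ((n + w) ^ suc m) n w ⟩
    n * (n + w) ^ suc m + w * (n + w) ^ suc m
      ≤⟨ ℕₚ.+-monoʳ-≤ (n * (n + w) ^ suc m) (ℕₚ.*-monoʳ-≤ w (^-difference≤n*^ n w m)) ⟩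
    n * (n + w) ^ suc m + w * (w ^ suc m + suc m * n * (n + w) ^ m)
      ≡⟨ lemma₁ n w m (w ^ suc m) ((n + w) ^ suc m) ((n + w) ^ m) ⟩
    w * w ^ suc m + n * (n + w) ^ suc m + suc m * n * (w * (n + w) ^ m)
      ≤⟨ ℕₚ.+-monoʳ-≤ (w * w ^ suc m + n * (n + w) ^ suc m)
           (ℕₚ.*-monoʳ-≤ (suc m * n) (ℕₚ.*-monoˡ-≤ ((n + w) ^ m) (ℕₚ.m≤n+m w n))) ⟩
    w * w ^ suc m + n * (n + w) ^ suc m + suc m * n * (n + w) ^ suc m
      ≡⟨ lemma₂ n m (w * w ^ suc m) ((n + w) ^ suc m) ⟩
    w * w ^ suc m + suc (suc m) * n * (n + w) ^ suc m ∎
    where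
    open ℕₚ.≤-Reasoning
    lemma₁ : ∀ n w m a b p → n * b + w * (a + suc m * n * p) ≡ w * a + n * b + suc m * n * (w * p)
    lemma₁ = solve-∀
    lemma₂ : ∀ n m a b → a + n * b + suc m * n * b ≡ a + suc (suc m) * n * b
    lemma₂ = solve-∀

  ^-∸-difference≤n*^ : ∀ n x m → x ^ suc m ≤ (x ∸ n) ^ suc m + suc m * n * x ^ m
  ^-∸-difference≤n*^ n x m with ℕₚ.≤-total n x
  ... | inj₁ n≤x = subst (λ y → y ^ suc m ≤ (x ∸ n) ^ suc m + suc m * n * y ^ m) (ℕₚ.m+[n∸m]≡n n≤x)
                     (^-difference≤n*^ n (x ∸ n) m)
  ... | inj₂ x≤n = ℕₚ.m≤n⇒m≤o+n ((x ∸ n) ^ suc m)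
                     (ℕₚ.*-monoˡ-≤ (x ^ m) (ℕₚ.≤-trans x≤n (ℕₚ.m≤m+n n (m * n))))

  vecProduct : ∀ {m} → Vec ℕ m → ℕ
  vecProduct = Vec.foldr _ _*_ 1

  -- The reciprocal of the volume of the simplex `x ≥ 0`, `Σ nᵢ xᵢ ≤ 1`.
  volume : ∀ {m} → Vec ℕ m → ℕ
  volume {m} ns = vecProduct ns * m !

  -- Normalises the recursion `alcoveCount-+`: the count of lower rank acquires the coefficient
  -- `suc m * n` of the power bounds.
  volume-∷ : ∀ n m p f a b → n * p * (suc m * f) * (a + b) ≡ suc m * n * (p * f * a) + n * p * (suc m * f) * b
  volume-∷ = solve-∀

  -- Geometrically, the unit cubes with upper corners at the counted points are disjoint and lie in
  -- the simplex dilated by `q`. The proof instead descends by `n`, matching `alcoveCount-+` with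
  -- the increment of the power.
  volume*alcoveCount≤ : ∀ {m} (ns : Vec ℕ m) → (∀ i → 0 < lookup ns i) → ∀ q → volume ns * alcoveCount ns q ≤ q ^ m
  volume*alcoveCount≤ []       _    zero    = z≤n
  volume*alcoveCount≤ []       _    (suc q) = ℕₚ.≤-refl
  volume*alcoveCount≤ {suc m} (n ∷ ns) ns>0 = <-rec _ step
    where
    0<n = ns>0 Fin.zero
    step : ∀ q → (∀ {r} → r < q → volume (n ∷ ns) * alcoveCount (n ∷ ns) r ≤ r ^ suc m) →
           volume (n ∷ ns) * alcoveCount (n ∷ ns) q ≤ q ^ suc m
    step q ih with ℕₚ.≤-total q n
    ... | inj₁ q≤n = subst (_≤ q ^ suc m)
            (sym (trans (cong (volume (n ∷ ns) *_) (alcoveCount-small n ns q≤n)) (ℕₚ.*-zeroʳ (volume (n ∷ ns))))) z≤n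
    ... | inj₂ n≤q with r , refl ← ℕₚ.m≤n⇒∃[o]m+o≡n n≤q = begin
      volume (n ∷ ns) * alcoveCount (n ∷ ns) (n + r)
        ≡⟨ cong (volume (n ∷ ns) *_) (alcoveCount-+ n ns r 0<n) ⟩
      volume (n ∷ ns) * (alcoveCount ns r + alcoveCount (n ∷ ns) r)
        ≡⟨ volume-∷ n m (vecProduct ns) (m !) (alcoveCount ns r) (alcoveCount (n ∷ ns) r) ⟩
      suc m * n * (volume ns * alcoveCount ns r) + volume (n ∷ ns) * alcoveCount (n ∷ ns) r
        ≤⟨ ℕₚ.+-mono-≤ (ℕₚ.*-monoʳ-≤ (suc m * n) (volume*alcoveCount≤ ns (ns>0 ∘ Fin.suc) r)) (ih (ℕₚ.m<n+m r 0<n)) ⟩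
      suc m * n * r ^ m + r ^ suc m
        ≡⟨ ℕₚ.+-comm (suc m * n * r ^ m) (r ^ suc m) ⟩
      r ^ suc m + suc m * n * r ^ m
        ≤⟨ n*^≤^-difference n r m ⟩
      (n + r) ^ suc m ∎
      where open ℕₚ.≤-Reasoning

  -- The same cubes cover the simplex dilated by `q - Σ nᵢ`. Positivity of `q` serves rank zero,
  -- where the left side is `1` while the count at `0` is `0`.
  ≤volume*alcoveCount : ∀ {m} (ns : Vec ℕ m) → (∀ i → 0 < lookup ns i) → ∀ q → 0 < q →
                        (q ∸ Vec.sum ns) ^ m ≤ volume ns * alcoveCount ns q
  ≤volume*alcoveCount []       _    (suc q) _ = ℕₚ.≤-refl
  ≤volume*alcoveCount {suc m} (n ∷ ns) ns>0 = <-rec _ step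
    where
    0<n = ns>0 Fin.zero
    S = Vec.sum ns
    step : ∀ q → (∀ {r} → r < q → 0 < r → (r ∸ (n + S)) ^ suc m ≤ volume (n ∷ ns) * alcoveCount (n ∷ ns) r) →
           0 < q → (q ∸ (n + S)) ^ suc m ≤ volume (n ∷ ns) * alcoveCount (n ∷ ns) q
    -- The second case is strict so that the remainder `r` is positive, as the induction hypothesis
    -- demands.
    step q ih 0<q with ℕₚ.≤-<-connex q n
    ... | inj₁ q≤n = subst (λ t → t ^ suc m ≤ volume (n ∷ ns) * alcoveCount (n ∷ ns) q)
            (sym (ℕₚ.m≤n⇒m∸n≡0 (ℕₚ.m≤n⇒m≤n+o S q≤n))) z≤n
    ... | inj₂ n<q with r , refl ← ℕₚ.m≤n⇒∃[o]m+o≡n (ℕₚ.<⇒≤ n<q) = begin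
      (n + r ∸ (n + S)) ^ suc m
        ≡⟨ cong (_^ suc m) (ℕₚ.[m+n]∸[m+o]≡n∸o n r S) ⟩
      (r ∸ S) ^ suc m
        ≤⟨ ^-∸-difference≤n*^ n (r ∸ S) m ⟩
      (r ∸ S ∸ n) ^ suc m + suc m * n * (r ∸ S) ^ m
        ≡⟨ cong (λ t → t ^ suc m + suc m * n * (r ∸ S) ^ m)
             (trans (ℕₚ.∸-+-assoc r S n) (cong (r ∸_) (ℕₚ.+-comm S n))) ⟩
      (r ∸ (n + S)) ^ suc m + suc m * n * (r ∸ S) ^ m
        ≤⟨ ℕₚ.+-mono-≤ (ih (ℕₚ.m<n+m r 0<n) 0<r)
             (ℕₚ.*-monoʳ-≤ (suc m * n) (≤volume*alcoveCount ns (ns>0 ∘ Fin.suc) r 0<r)) ⟩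
      volume (n ∷ ns) * alcoveCount (n ∷ ns) r + suc m * n * (volume ns * alcoveCount ns r)
        ≡⟨ ℕₚ.+-comm (volume (n ∷ ns) * alcoveCount (n ∷ ns) r) _ ⟩
      suc m * n * (volume ns * alcoveCount ns r) + volume (n ∷ ns) * alcoveCount (n ∷ ns) r
        ≡⟨ volume-∷ n m (vecProduct ns) (m !) (alcoveCount ns r) (alcoveCount (n ∷ ns) r) ⟨
      volume (n ∷ ns) * (alcoveCount ns r + alcoveCount (n ∷ ns) r)
        ≡⟨ cong (volume (n ∷ ns) *_) (alcoveCount-+ n ns r 0<n) ⟨
      volume (n ∷ ns) * alcoveCount (n ∷ ns) (n + r) ∎
      where
      open ℕₚ.≤-Reasoning
      0<r : 0 < r
      0<r = ℕₚ.+-cancelˡ-< n 0 r (subst (_< n + r) (sym (ℕₚ.+-identityʳ n)) n<q)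

  -- Upper and lower bounds for `χ`.

  unique⊆⇒length≤ : ∀ {A : Set} {xs ys : List A} → Unique xs → (∀ {x} → x ∈ xs → x ∈ ys) → length xs ≤ length ys
  unique⊆⇒length≤ [] sub = z≤n
  unique⊆⇒length≤ {xs = x ∷ xs} (x∉ ∷ xs!) sub with ys , zs , refl ← ∈-∃++ (sub (here refl)) =
    subst (suc (length xs) ≤_) (sym (length-++-sucʳ ys x zs)) (s≤s (unique⊆⇒length≤ xs! sub′))
    where
    sub′ : ∀ {y} → y ∈ xs → y ∈ ys ++ zs
    sub′ y∈ with ∈-++⁻ ys (sub (there y∈))
    ... | inj₁ y∈ys        = ∈-++⁺ˡ y∈ys
    ... | inj₂ (here refl) = contradiction refl (LAll.lookup x∉ y∈)
    ... | inj₂ (there y∈zs) = ∈-++⁺ʳ ys y∈zs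

  length-concatMap-≤ : ∀ {A B : Set} (f : A → List B) k xs → (∀ {x} → x ∈ xs → length (f x) ≤ k) →
                       length (concatMap f xs) ≤ length xs * k
  length-concatMap-≤ f k []       _   = z≤n
  length-concatMap-≤ f k (x ∷ xs) f≤k = subst (_≤ k + length xs * k) (sym (length-++ (f x)))
    (ℕₚ.+-mono-≤ (f≤k (here refl)) (length-concatMap-≤ f k xs (f≤k ∘ there)))

  length-allVecs : ∀ m q → length (allVecs m q) ≡ q ^ m
  length-allVecs zero    q = refl
  length-allVecs (suc m) q = trans (go (allFin q)) (cong (_* q ^ m) (length-tabulate {n = q} id))
    where
    go : ∀ is → length (concatMap (λ i → List.map (i ∷_) (allVecs m q)) is) ≡ length is * q ^ m
    go []       = refl
    go (i ∷ is) = trans (length-++ (List.map (i ∷_) (allVecs m q)))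
      (cong₂ _+_ (trans (length-map (i ∷_) (allVecs m q)) (length-allVecs m q)) (go is))

  χ≤ : ∀ {m} (R : List (Vec ℤ m)) q → χ R q ≤ q ^ m
  χ≤ {m} R q = subst (χ R q ≤_) (length-allVecs m q) (length-filter (good? q R) (allVecs m q))

  ·-removeAt : ∀ {m q} (z : Vec (Fin q) (suc m)) (v : Vec ℤ (suc m)) i →
               toℤvec z · v ≡ + toℕ (lookup z i) ℤ.* lookup v i ℤ.+ toℤvec (removeAt z i) · removeAt v i
  ·-removeAt (x ∷ z) (y ∷ v) Fin.zero = refl
  ·-removeAt (x ∷ z@(_ ∷ _)) (y ∷ v@(_ ∷ _)) (Fin.suc i) =
    trans (cong (ℤ._+_ (+ toℕ x ℤ.* y)) (·-removeAt z v i))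
      (lemma (+ toℕ x ℤ.* y) (+ toℕ (lookup z i) ℤ.* lookup v i) (toℤvec (removeAt z i) · removeAt v i))
    where
    lemma : ∀ a b c → a ℤ.+ (b ℤ.+ c) ≡ b ℤ.+ (a ℤ.+ c)
    lemma = ℤSolver.solve-∀

  fin-∣-difference : ∀ {q} (i j : Fin q) → q ∣ ∣ + toℕ i ℤ.- + toℕ j ∣ → i ≡ j
  fin-∣-difference {q} i j q∣ = toℕ-injective (ℤₚ.+-injective (ℤₚ.i-j≡0⇒i≡j (+ toℕ i) (+ toℕ j) (ℤₚ.∣i∣≡0⇒i≡0 (zero′ _ refl))))
    where
    d<q : ∣ + toℕ i ℤ.- + toℕ j ∣ < q
    d<q = ℕₚ.≤-<-trans (subst (λ t → ∣ t ∣ ≤ toℕ i ℕ.⊔ toℕ j) (sym (ℤₚ.[+m]-[+n]≡m⊖n (toℕ i) (toℕ j)))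
            (ℤₚ.∣m⊝n∣≤m⊔n (toℕ i) (toℕ j)))
            (ℕₚ.⊔-lub (toℕ<n i) (toℕ<n j))
    zero′ : ∀ d → ∣ + toℕ i ℤ.- + toℕ j ∣ ≡ d → d ≡ 0
    zero′ zero    _  = refl
    zero′ (suc d) eq = contradiction (ℕᵈ.∣⇒≤ (subst (q ∣_) eq q∣)) (ℕₚ.<⇒≱ (subst (_< q) eq d<q))

  -- If two zeros agree away from `i`, subtracting leaves `lookup v i` times the difference of their
  -- entries at `i`, and the first factor is a unit modulo `q`.
  removeAt-injective-on-zeros : ∀ {m q} {v : Vec ℤ (suc m)} i → Coprime q ∣ lookup v i ∣ → {y z : Vec (Fin q) (suc m)} →
    q ∣ ∣ toℤvec y · v ∣ → q ∣ ∣ toℤvec z · v ∣ → removeAt y i ≡ removeAt z i → y ≡ z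
  removeAt-injective-on-zeros {q = q} {v} i coprime {y} {z} q∣y q∣z eq = begin
    y                                             ≡⟨ insertAt-removeAt y i ⟨
    insertAt (removeAt y i) i (lookup y i)        ≡⟨ cong₂ (λ u → insertAt u i) eq yᵢ≡zᵢ ⟩
    insertAt (removeAt z i) i (lookup z i)        ≡⟨ insertAt-removeAt z i ⟩
    z                                             ∎
    where
    open ≡-Reasoning
    a = + toℕ (lookup y i)
    b = + toℕ (lookup z i)
    r = toℤvec (removeAt z i) · removeAt v i
    lemma : ∀ a b v r → (a ℤ.* v ℤ.+ r) ℤ.- (b ℤ.* v ℤ.+ r) ≡ v ℤ.* (a ℤ.- b)
    lemma = ℤSolver.solve-∀
    difference : toℤvec y · v ℤ.- toℤvec z · v ≡ lookup v i ℤ.* (a ℤ.- b)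
    difference = trans
      (cong₂ ℤ._-_ (trans (·-removeAt y v i) (cong (λ u → a ℤ.* lookup v i ℤ.+ toℤvec u · removeAt v i) eq)) (·-removeAt z v i))
      (lemma a b (lookup v i) r)
    q∣difference : q ∣ ∣ lookup v i ∣ * ∣ a ℤ.- b ∣
    q∣difference = subst (q ∣_) (trans (cong ∣_∣ difference) (ℤₚ.∣i*j∣≡∣i∣*∣j∣ (lookup v i) (a ℤ.- b)))
      (ℤᵈ.∣⇒∣ᵤ (ℤᵈ.∣m∣n⇒∣m-n {+ q} (ℤᵈ.∣ᵤ⇒∣ {+ q} {toℤvec y · v} q∣y) (ℤᵈ.∣ᵤ⇒∣ {+ q} {toℤvec z · v} q∣z)))
    yᵢ≡zᵢ : lookup y i ≡ lookup z i
    yᵢ≡zᵢ = fin-∣-difference (lookup y i) (lookup z i) (Coprime.coprime-divisor coprime q∣difference)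

  zeros : ∀ {m} q → Vec ℤ m → List (Vec (Fin q) m)
  zeros {m} q β = filter (λ z → q ∣? ∣ toℤvec z · β ∣) (allVecs m q)

  length-zeros : ∀ {m q} (β : Vec ℤ (suc m)) i → Coprime q ∣ lookup β i ∣ → length (zeros q β) ≤ q ^ m
  length-zeros {m} {q} β i coprime = begin
    length (zeros q β)                                   ≡⟨ length-map (λ z → removeAt z i) (zeros q β) ⟨
    length (List.map (λ z → removeAt z i) (zeros q β))
      ≤⟨ unique⊆⇒length≤ (map-unique-on injective (Unique.filter⁺ P? (allVecs-unique (suc m) q)))
           (λ {x} _ → ∈-allVecs x) ⟩
    length (allVecs m q)                                 ≡⟨ length-allVecs m q ⟩
    q ^ m                                                ∎
    where
    open ℕₚ.≤-Reasoning
    P? = λ (z : Vec (Fin q) (suc m)) → q ∣? ∣ toℤvec z · β ∣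
    injective : ∀ {y z} → y ∈ zeros q β → z ∈ zeros q β → removeAt y i ≡ removeAt z i → y ≡ z
    injective {y} {z} y∈ z∈ = removeAt-injective-on-zeros {v = β} i coprime
      (proj₂ (∈-filter⁻ P? {xs = allVecs (suc m) q} y∈)) (proj₂ (∈-filter⁻ P? {xs = allVecs (suc m) q} z∈))

  -- Union bound: a vector that is not good is a zero of some positive root.
  χ≥ : ∀ {m} (R : List (Vec ℤ (suc m))) q →
       (∀ {β} → β ∈ positiveRoots R → Σ (Fin (suc m)) λ i → Coprime q ∣ lookup β i ∣) →
       q ^ suc m ≤ χ R q + length (positiveRoots R) * q ^ m
  χ≥ {m} R q coprime = begin
    q ^ suc m                                               ≡⟨ length-allVecs (suc m) q ⟨
    length (allVecs (suc m) q)                              ≤⟨ unique⊆⇒length≤ (allVecs-unique (suc m) q) cover ⟩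
    length (good ++ concatMap (zeros q) (positiveRoots R))  ≡⟨ length-++ good ⟩
    χ R q + length (concatMap (zeros q) (positiveRoots R))
      ≤⟨ ℕₚ.+-monoʳ-≤ (χ R q) (length-concatMap-≤ (zeros q) (q ^ m) (positiveRoots R)
           (λ {β} β∈ → let i , c = coprime β∈ in length-zeros β i c)) ⟩
    χ R q + length (positiveRoots R) * q ^ m                ∎
    where
    open ℕₚ.≤-Reasoning
    good = filter (good? q R) (allVecs (suc m) q)
    cover : ∀ {z} → z ∈ allVecs (suc m) q → z ∈ good ++ concatMap (zeros q) (positiveRoots R)
    cover {z} z∈ with good? q R z
    ... | yes g = ∈-++⁺ˡ (∈-filter⁺ (good? q R) z∈ g)
    ... | no ¬g with β , β∈ , ¬¬∣ ← find (LAll.¬All⇒Any¬ (nonzeroMod? q z) (positiveRoots R) ¬g) =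
      ∈-++⁺ʳ good (∈-concatMap⁺ (zeros q) (lose β∈ (∈-filter⁺ (λ z → q ∣? ∣ toℤvec z · β ∣) z∈
        (decidable-stable (q ∣? ∣ toℤvec z · β ∣) ¬¬∣))))

  -- Evaluation of the constant along an arithmetic progression.

  1+k*n!-coprime : ∀ k {n b} → 0 < b → b ≤ n → Coprime (suc (k * n !)) b
  1+k*n!-coprime k {n} {suc b} _ b≤n {d} (d∣q , d∣b) = ℕᵈ.∣1⇒≡1
    (ℕᵈ.∣m+n∣m⇒∣n (subst (d ∣_) (ℕₚ.+-comm 1 (k * n !)) d∣q)
      (ℕᵈ.∣n⇒∣m*n k (ℕᵈ.∣-trans d∣b (ℕᵈ.∣-trans (ℕᵈ.m∣m*n (b !)) (ℕᵈ.m≤n⇒m!∣n! b≤n)))))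

  slope-≤ : ∀ a b e t → 0 < t → (∀ k → a * suc (k * t) ≤ b * suc (k * t) + e) → a ≤ b
  slope-≤ a b e t 0<t ineq = ℕₚ.≮⇒≥ λ b<a → ℕₚ.<⇒≱ (strict b<a) (ineq e)
    where
    -- The instance `k = e` decides: this `q` exceeds `e`, so a slope larger by one outgrows the
    -- error.
    q = suc (e * t)
    strict : b < a → b * q + e < a * q
    strict b<a = begin-strict
      b * q + e    <⟨ ℕₚ.+-monoʳ-< (b * q) (s≤s (ℕₚ.m≤m*n e t {{ℕ.>-nonZero 0<t}})) ⟩
      b * q + q    ≡⟨ ℕₚ.+-comm (b * q) q ⟩
      suc b * q    ≤⟨ ℕₚ.*-monoˡ-≤ q b<a ⟩
      a * q        ∎
      where open ℕₚ.≤-Reasoning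

  cancel-power : ∀ a b e q m → 0 < q → a * q ^ suc m ≤ b * q ^ suc m + e * q ^ m → a * q ≤ b * q + e
  cancel-power a b e q@(suc _) m _ ineq = ℕₚ.*-cancelʳ-≤ (a * q) (b * q + e) (q ^ m) {{ℕₚ.m^n≢0 q m}}
    (subst₂ _≤_ (sym (ℕₚ.*-assoc a q (q ^ m))) (lemma b q e (q ^ m)) ineq)
    where
    lemma : ∀ b q e p → b * (q * p) + e * p ≡ (b * q + e) * p
    lemma = solve-∀

  -- Compares the leading coefficients of both sides of χ′ q ≡ N * alcoveCount ns q along q ≡ 1 mod t.
  leading-coefficient : ∀ {m} (ns : Vec ℕ (suc m)) → (∀ i → 0 < lookup ns i) → ∀ N r t → 0 < t → (χ′ : ℕ → ℕ) →
    (∀ q → 0 < q → χ′ q ≡ N * alcoveCount ns q) →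
    (∀ q → χ′ q ≤ q ^ suc m) →
    (∀ k → suc (k * t) ^ suc m ≤ χ′ (suc (k * t)) + r * suc (k * t) ^ m) →
    N ≡ volume ns
  leading-coefficient {m} ns ns>0 N r t 0<t χ′ factor upper lower = ℕₚ.≤-antisym
    (slope-≤ N M (N * (suc m * S)) t 0<t (λ k → cancel-power N M _ (suc (k * t)) m (s≤s z≤n) (N-ineq (suc (k * t)) (s≤s z≤n))))
    (slope-≤ M N (M * r) t 0<t (λ k → cancel-power M N (M * r) (suc (k * t)) m (s≤s z≤n) (M-ineq k)))
    where
    open ℕₚ.≤-Reasoning
    M = volume ns
    S = Vec.sum ns
    -- Scaling by `M` turns the count into `M * alcoveCount ns q`, which lies between pure powers of
    -- `q ∸ S` and `q`.
    M*χ : ∀ q → 0 < q → M * χ′ q ≡ N * (M * alcoveCount ns q)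
    M*χ q 0<q = trans (cong (M *_) (factor q 0<q)) (lemma M N (alcoveCount ns q))
      where
      lemma : ∀ a b c → a * (b * c) ≡ b * (a * c)
      lemma = solve-∀
    N-ineq : ∀ q → 0 < q → N * q ^ suc m ≤ M * q ^ suc m + N * (suc m * S) * q ^ m
    N-ineq q 0<q = begin
      N * q ^ suc m                                             ≤⟨ ℕₚ.*-monoʳ-≤ N (^-∸-difference≤n*^ S q m) ⟩
      N * ((q ∸ S) ^ suc m + suc m * S * q ^ m)                 ≡⟨ lemma N ((q ∸ S) ^ suc m) (suc m * S) (q ^ m) ⟩
      N * (q ∸ S) ^ suc m + N * (suc m * S) * q ^ m             ≤⟨ ℕₚ.+-monoˡ-≤ _ (ℕₚ.*-monoʳ-≤ N (≤volume*alcoveCount ns ns>0 q 0<q)) ⟩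
      N * (M * alcoveCount ns q) + N * (suc m * S) * q ^ m      ≡⟨ cong (_+ N * (suc m * S) * q ^ m) (M*χ q 0<q) ⟨
      M * χ′ q + N * (suc m * S) * q ^ m                        ≤⟨ ℕₚ.+-monoˡ-≤ _ (ℕₚ.*-monoʳ-≤ M (upper q)) ⟩
      M * q ^ suc m + N * (suc m * S) * q ^ m                   ∎
      where
      lemma : ∀ N a s p → N * (a + s * p) ≡ N * a + N * s * p
      lemma = solve-∀
    M-ineq : ∀ k → let q = suc (k * t) in M * q ^ suc m ≤ N * q ^ suc m + M * r * q ^ m
    M-ineq k = begin
      M * q ^ suc m                              ≤⟨ ℕₚ.*-monoʳ-≤ M (lower k) ⟩
      M * (χ′ q + r * q ^ m)                     ≡⟨ lemma M (χ′ q) r (q ^ m) ⟩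
      M * χ′ q + M * r * q ^ m                   ≡⟨ cong (_+ M * r * q ^ m) (M*χ q (s≤s z≤n)) ⟩
      N * (M * alcoveCount ns q) + M * r * q ^ m ≤⟨ ℕₚ.+-monoˡ-≤ (M * r * q ^ m) (ℕₚ.*-monoʳ-≤ N (volume*alcoveCount≤ ns ns>0 q)) ⟩
      N * q ^ suc m + M * r * q ^ m              ∎
      where
      q = suc (k * t)
      lemma : ∀ M a r p → M * (a + r * p) ≡ M * a + M * r * p
      lemma = solve-∀

  lookup≤sum : ∀ {m} (ns : Vec ℕ m) i → lookup ns i ≤ Vec.sum ns
  lookup≤sum (n ∷ ns) Fin.zero    = ℕₚ.m≤m+n n (Vec.sum ns)
  lookup≤sum (n ∷ ns) (Fin.suc i) = ℕₚ.m≤n⇒m≤o+n n (lookup≤sum ns i)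

  ones·map-+ : ∀ {m} (ns : Vec ℕ m) → ones · Vec.map +_ ns ≡ + Vec.sum ns
  ones·map-+ []       = refl
  ones·map-+ (n ∷ ns) = cong₂ ℤ._+_ (ℤₚ.*-identityˡ (+ n)) (ones·map-+ ns)

  module _ {m : ℕ} {G : Gram m} {R : List (Vec ℤ m)} (system : IsIrredRootSystem m G R) where
    open IsIrredRootSystem system

    nonneg-root-entry : ∀ {β} → β ∈ R → Nonneg β → Σ (Fin m) λ i → + 0 ℤ.< lookup β i
    nonneg-root-entry {β} β∈R β≥0 with any? (λ i → + 0 ℤ.<? lookup β i)
    ... | yes found = found
    ... | no none   = contradiction (subst (_∈ R) (lookup-extensional β _ λ i →
            trans (ℤₚ.≤-antisym (ℤₚ.≮⇒≥ λ lt → none (i , lt)) (lookup⁺ β≥0 i)) (sym (lookup-replicate i (+ 0)))) β∈R) nonzero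

    module _ (ns : Vec ℕ m) (highest : IsHighestRoot R (Vec.map +_ ns)) where

      marks-positive : ∀ i → 0 < lookup ns i
      marks-positive i = ℤₚ.drop‿+<+ (subst (+ 0 ℤ.<_) (lookup-map i +_ ns) (highest-positive system highest i))

      χ-alcoveCount : ∀ q → 0 < q → χ R q ≡ χ R (suc (Vec.sum ns)) * alcoveCount ns q
      χ-alcoveCount q 0<q = χ-factors system ns highest (suc (Vec.sum ns)) (cong (ℤ._+_ (+ 1)) (ones·map-+ ns)) q (ℤ.+<+ 0<q)

      -- A root has a nonzero coefficient, and the highest root caps it by a mark, hence by the sum
      -- of the marks.
      positiveRoot-coprime : ∀ k {β} → β ∈ positiveRoots R →
                             Σ (Fin m) λ i → Coprime (suc (k * Vec.sum ns !)) ∣ lookup β i ∣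
      positiveRoot-coprime k {β} β∈ with β∈R , β≥0 ← ∈-filter⁻ nonneg? {xs = R} β∈
        with i , βᵢ>0 ← nonneg-root-entry β∈R β≥0 = i , 1+k*n!-coprime k (∣∣-mono-< ℤₚ.≤-refl βᵢ>0) βᵢ≤
        where
        ∣∣-mono-≤ : ∀ {a n} → + 0 ℤ.< a → a ℤ.≤ + n → ∣ a ∣ ≤ n
        ∣∣-mono-≤ {+ a} _ (ℤ.+≤+ le) = le
        βᵢ≤ : ∣ lookup β i ∣ ≤ Vec.sum ns
        βᵢ≤ = ℕₚ.≤-trans (∣∣-mono-≤ βᵢ>0 (subst (lookup β i ℤ.≤_) (lookup-map i +_ ns) (proj₂ highest β β∈ i))) (lookup≤sum ns i)

  χ-coxeter : ∀ {m} {G : Gram m} {R : List (Vec ℤ m)} (system : IsIrredRootSystem m G R)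
              (ns : Vec ℕ m) → IsHighestRoot R (Vec.map +_ ns) → χ R (suc (Vec.sum ns)) ≡ volume ns
  -- In rank zero the only vector is the zero vector, so no highest root exists.
  χ-coxeter {zero}  system [] highest = contradiction (highest∈R system highest) (IsIrredRootSystem.nonzero system)
  χ-coxeter {suc m} {R = R} system ns highest = leading-coefficient ns (marks-positive system ns highest)
    (χ R (suc (Vec.sum ns))) (length (positiveRoots R)) (Vec.sum ns !) (ℕₚ.1≤n! (Vec.sum ns)) (χ R)
    (χ-alcoveCount system ns highest) (χ≤ R)
    (λ k → χ≥ R (suc (k * Vec.sum ns !)) (positiveRoot-coprime system ns highest k))

open AlcoveCounting

-- Formal power series and the generating function of the alcove counts.

module GeneratingFunction where
  open import Data.Integer using (-_; _+_; _-_; _*_; _≤_; _<_)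
  open import Data.Integer.Tactic.RingSolver using (solve-∀)

  -- Splitting `f` as `f 0 + t (f ∘ suc)` yields the recursion behind the coefficientwise inductions
  -- on products.
  ⊛-suc : ∀ (f g : FPS) q → (f ⊛ g) (suc q) ≡ f 0 * g (suc q) + ((f ∘ suc) ⊛ g) q
  ⊛-suc f g q = cong (λ xs → f 0 * g (suc q) + sumℤ xs)
    (trans (map-applyUpTo suc (λ k → f k * g (suc q ℕ.∸ k)) (suc q))
           (sym (map-applyUpTo id (λ k → f (suc k) * g (q ℕ.∸ k)) (suc q))))

  ⊛-cong : ∀ {f f′ g g′ : FPS} → f ≗ f′ → g ≗ g′ → f ⊛ g ≗ f′ ⊛ g′
  ⊛-cong {f} {f′} {g} {g′} p r zero = cong₂ (λ a b → a * b + + 0) (p 0) (r 0)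
  ⊛-cong {f} {f′} {g} {g′} p r (suc q) = begin
    (f ⊛ g) (suc q)                               ≡⟨ ⊛-suc f g q ⟩
    f 0 * g (suc q) + ((f ∘ suc) ⊛ g) q           ≡⟨ cong₂ _+_ (cong₂ _*_ (p 0) (r (suc q))) (⊛-cong (p ∘ suc) r q) ⟩
    f′ 0 * g′ (suc q) + ((f′ ∘ suc) ⊛ g′) q       ≡⟨ ⊛-suc f′ g′ q ⟨
    (f′ ⊛ g′) (suc q)                             ∎
    where open ≡-Reasoning

  ⊛-distribʳ-- : ∀ (f g k : FPS) → (λ q → f q - g q) ⊛ k ≗ λ q → (f ⊛ k) q - (g ⊛ k) q
  ⊛-distribʳ-- f g k zero = lemma (f 0) (g 0) (k 0)
    where
    lemma : ∀ a b c → (a - b) * c + + 0 ≡ (a * c + + 0) - (b * c + + 0)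
    lemma = solve-∀
  ⊛-distribʳ-- f g k (suc q) = begin
    ((λ q → f q - g q) ⊛ k) (suc q)
      ≡⟨ ⊛-suc (λ q → f q - g q) k q ⟩
    (f 0 - g 0) * k (suc q) + ((λ q → f (suc q) - g (suc q)) ⊛ k) q
      ≡⟨ cong (_+_ ((f 0 - g 0) * k (suc q))) (⊛-distribʳ-- (f ∘ suc) (g ∘ suc) k q) ⟩
    (f 0 - g 0) * k (suc q) + (((f ∘ suc) ⊛ k) q - ((g ∘ suc) ⊛ k) q)
      ≡⟨ lemma (f 0) (g 0) (k (suc q)) _ _ ⟩
    (f 0 * k (suc q) + ((f ∘ suc) ⊛ k) q) - (g 0 * k (suc q) + ((g ∘ suc) ⊛ k) q)
      ≡⟨ cong₂ _-_ (⊛-suc f k q) (⊛-suc g k q) ⟨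
    (f ⊛ k) (suc q) - (g ⊛ k) (suc q) ∎
    where
    open ≡-Reasoning
    lemma : ∀ a b c x y → (a - b) * c + (x - y) ≡ (a * c + x) - (b * c + y)
    lemma = solve-∀

  ⊛-distribˡ-- : ∀ (f g k : FPS) → f ⊛ (λ q → g q - k q) ≗ λ q → (f ⊛ g) q - (f ⊛ k) q
  ⊛-distribˡ-- f g k zero = lemma (f 0) (g 0) (k 0)
    where
    lemma : ∀ a b c → a * (b - c) + + 0 ≡ (a * b + + 0) - (a * c + + 0)
    lemma = solve-∀
  ⊛-distribˡ-- f g k (suc q) = begin
    (f ⊛ (λ q → g q - k q)) (suc q)
      ≡⟨ ⊛-suc f (λ q → g q - k q) q ⟩
    f 0 * (g (suc q) - k (suc q)) + ((f ∘ suc) ⊛ (λ q → g q - k q)) q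
      ≡⟨ cong (_+_ (f 0 * (g (suc q) - k (suc q)))) (⊛-distribˡ-- (f ∘ suc) g k q) ⟩
    f 0 * (g (suc q) - k (suc q)) + (((f ∘ suc) ⊛ g) q - ((f ∘ suc) ⊛ k) q)
      ≡⟨ lemma (f 0) (g (suc q)) (k (suc q)) _ _ ⟩
    (f 0 * g (suc q) + ((f ∘ suc) ⊛ g) q) - (f 0 * k (suc q) + ((f ∘ suc) ⊛ k) q)
      ≡⟨ cong₂ _-_ (⊛-suc f g q) (⊛-suc f k q) ⟨
    (f ⊛ g) (suc q) - (f ⊛ k) (suc q) ∎
    where
    open ≡-Reasoning
    lemma : ∀ a b c x y → a * (b - c) + (x - y) ≡ (a * b + x) - (a * c + y)
    lemma = solve-∀

  -- Multiplication by t^n.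
  shift : ℕ → FPS → FPS
  shift zero    f q       = f q
  shift (suc n) f zero    = + 0
  shift (suc n) f (suc q) = shift n f q

  shift-cong : ∀ n {f g : FPS} → f ≗ g → shift n f ≗ shift n g
  shift-cong zero    eq q       = eq q
  shift-cong (suc n) eq zero    = refl
  shift-cong (suc n) eq (suc q) = shift-cong n eq q

  shift-+ : ∀ n (f : FPS) q → shift n f (n ℕ.+ q) ≡ f q
  shift-+ zero    f q = refl
  shift-+ (suc n) f q = shift-+ n f q

  shift-< : ∀ n (f : FPS) {q} → q ℕ.< n → shift n f q ≡ + 0
  shift-< (suc n) f {zero}  _ = refl
  shift-< (suc n) f {suc q} (ℕ.s≤s lt) = shift-< n f lt

  shift-sucʳ : ∀ n (f : FPS) → shift (suc n) f ≗ shift n (shift 1 f)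
  shift-sucʳ zero    f q       = refl
  shift-sucʳ (suc n) f zero    = refl
  shift-sucʳ (suc n) f (suc q) = shift-sucʳ n f q

  shift-shift : ∀ a b (f : FPS) → shift a (shift b f) ≗ shift (a ℕ.+ b) f
  shift-shift zero    b f q       = refl
  shift-shift (suc a) b f zero    = refl
  shift-shift (suc a) b f (suc q) = shift-shift a b f q

  shift-comm : ∀ a b (f : FPS) → shift a (shift b f) ≗ shift b (shift a f)
  shift-comm a b f q = trans (shift-shift a b f q)
    (trans (cong (λ n → shift n f q) (ℕₚ.+-comm a b)) (sym (shift-shift b a f q)))

  shift-- : ∀ n (f g : FPS) → shift n (λ q → f q - g q) ≗ λ q → shift n f q - shift n g q
  shift-- zero    f g q       = refl
  shift-- (suc n) f g zero    = refl
  shift-- (suc n) f g (suc q) = shift-- n f g q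

  shift-* : ∀ n c (f : FPS) → shift n (λ q → c * f q) ≗ λ q → c * shift n f q
  shift-* zero    c f q       = refl
  shift-* (suc n) c f zero    = sym (ℤₚ.*-zeroʳ c)
  shift-* (suc n) c f (suc q) = shift-* n c f q

  monomial-suc : ∀ c n q → monomial c (suc n) (suc q) ≡ monomial c n q
  monomial-suc c n q with q ℕ.≟ n | suc q ℕ.≟ suc n
  ... | yes _   | yes _   = refl
  ... | no _    | no _    = refl
  ... | yes q≡n | no ¬p   = contradiction (cong suc q≡n) ¬p
  ... | no q≢n  | yes p   = contradiction (ℕₚ.suc-injective p) q≢n

  shift-monomial : ∀ a c n → shift a (monomial c n) ≗ monomial c (a ℕ.+ n)
  shift-monomial zero    c n q       = refl
  shift-monomial (suc a) c n zero    = refl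
  shift-monomial (suc a) c n (suc q) = trans (shift-monomial a c n q) (sym (monomial-suc c (a ℕ.+ n) q))

  ⊛-shiftˡ : ∀ n (f g : FPS) → shift n f ⊛ g ≗ shift n (f ⊛ g)
  ⊛-shiftˡ zero    f g q       = refl
  ⊛-shiftˡ (suc n) f g zero    = refl
  ⊛-shiftˡ (suc n) f g (suc q) = begin
    (shift (suc n) f ⊛ g) (suc q)              ≡⟨ ⊛-suc (shift (suc n) f) g q ⟩
    + 0 * g (suc q) + (shift n f ⊛ g) q        ≡⟨ ℤₚ.+-identityˡ _ ⟩
    (shift n f ⊛ g) q                          ≡⟨ ⊛-shiftˡ n f g q ⟩
    shift n (f ⊛ g) q                          ∎
    where open ≡-Reasoning

  ⊛-shift1ʳ : ∀ (f g : FPS) → f ⊛ shift 1 g ≗ shift 1 (f ⊛ g)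
  ⊛-shift1ʳ f g zero = trans (ℤₚ.+-identityʳ (f 0 * + 0)) (ℤₚ.*-zeroʳ (f 0))
  ⊛-shift1ʳ f g (suc q) = begin
    (f ⊛ shift 1 g) (suc q)                    ≡⟨ ⊛-suc f (shift 1 g) q ⟩
    f 0 * g q + ((f ∘ suc) ⊛ shift 1 g) q      ≡⟨ cong (_+_ (f 0 * g q)) (⊛-shift1ʳ (f ∘ suc) g q) ⟩
    f 0 * g q + shift 1 ((f ∘ suc) ⊛ g) q      ≡⟨ last q ⟩
    (f ⊛ g) q                                  ∎
    where
    open ≡-Reasoning
    last : ∀ q → f 0 * g q + shift 1 ((f ∘ suc) ⊛ g) q ≡ (f ⊛ g) q
    last zero    = refl
    last (suc q) = sym (⊛-suc f g q)

  ⊛-shiftʳ : ∀ n (f g : FPS) → f ⊛ shift n g ≗ shift n (f ⊛ g)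
  ⊛-shiftʳ zero    f g q = refl
  ⊛-shiftʳ (suc n) f g q = begin
    (f ⊛ shift (suc n) g) q          ≡⟨ ⊛-cong {f} (λ _ → refl) (shift-sucʳ n g) q ⟩
    (f ⊛ shift n (shift 1 g)) q      ≡⟨ ⊛-shiftʳ n f (shift 1 g) q ⟩
    shift n (f ⊛ shift 1 g) q        ≡⟨ shift-cong n (⊛-shift1ʳ f g) q ⟩
    shift n (shift 1 (f ⊛ g)) q      ≡⟨ shift-sucʳ n (f ⊛ g) q ⟨
    shift (suc n) (f ⊛ g) q          ∎
    where open ≡-Reasoning

  ⊛-zeroˡ : ∀ (g : FPS) → (λ _ → + 0) ⊛ g ≗ λ _ → + 0
  ⊛-zeroˡ g zero    = refl
  ⊛-zeroˡ g (suc q) = trans (⊛-suc (λ _ → + 0) g q) (trans (ℤₚ.+-identityˡ _) (⊛-zeroˡ g q))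

  ⊛-identityˡ : ∀ (g : FPS) → one ⊛ g ≗ g
  ⊛-identityˡ g zero    = trans (ℤₚ.+-identityʳ _) (ℤₚ.*-identityˡ (g 0))
  ⊛-identityˡ g (suc q) = trans (⊛-suc one g q)
    (trans (cong₂ _+_ (ℤₚ.*-identityˡ (g (suc q))) (⊛-zeroˡ g q)) (ℤₚ.+-identityʳ _))

  ⊛-identityʳ : ∀ (f : FPS) → f ⊛ one ≗ f
  ⊛-identityʳ f zero    = trans (ℤₚ.+-identityʳ _) (ℤₚ.*-identityʳ (f 0))
  ⊛-identityʳ f (suc q) = trans (⊛-suc f one q)
    (trans (cong₂ _+_ (ℤₚ.*-zeroʳ (f 0)) (⊛-identityʳ (f ∘ suc) q)) (ℤₚ.+-identityˡ _))

  -- Multiplication by 1 - t^n.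
  Δ : ℕ → FPS → FPS
  Δ n f q = f q - shift n f q

  Δ-cong : ∀ n {f g : FPS} → f ≗ g → Δ n f ≗ Δ n g
  Δ-cong n eq q = cong₂ _-_ (eq q) (shift-cong n eq q)

  oneMinusT^≗Δ : ∀ n → oneMinusT^ n ≗ Δ n one
  oneMinusT^≗Δ n q = cong (_-_ (one q))
    (sym (trans (shift-monomial n (+ 1) 0 q) (cong (λ k → monomial (+ 1) k q) (ℕₚ.+-identityʳ n))))

  -- Transfers a factor to the left operand, where it acts as `Δ`; a right-nested denominator is
  -- thus absorbed one factor at a time.
  ⊛-oneMinusT^ : ∀ n (f g : FPS) → f ⊛ (oneMinusT^ n ⊛ g) ≗ Δ n f ⊛ g
  ⊛-oneMinusT^ n f g q = begin
    (f ⊛ (oneMinusT^ n ⊛ g)) q               ≡⟨ ⊛-cong {f} (λ _ → refl) step q ⟩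
    (f ⊛ Δ n g) q                            ≡⟨ ⊛-distribˡ-- f g (shift n g) q ⟩
    (f ⊛ g) q - (f ⊛ shift n g) q            ≡⟨ cong (_-_ ((f ⊛ g) q)) (trans (⊛-shiftʳ n f g q) (sym (⊛-shiftˡ n f g q))) ⟩
    (f ⊛ g) q - (shift n f ⊛ g) q            ≡⟨ ⊛-distribʳ-- f (shift n f) g q ⟨
    (Δ n f ⊛ g) q                            ∎
    where
    open ≡-Reasoning
    step : oneMinusT^ n ⊛ g ≗ Δ n g
    step r = begin
      (oneMinusT^ n ⊛ g) r                   ≡⟨ ⊛-cong {g = g} (oneMinusT^≗Δ n) (λ _ → refl) r ⟩
      (Δ n one ⊛ g) r                        ≡⟨ ⊛-distribʳ-- one (shift n one) g r ⟩
      (one ⊛ g) r - (shift n one ⊛ g) r      ≡⟨ cong₂ _-_ (⊛-identityˡ g r)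
                                                  (trans (⊛-shiftˡ n one g r) (shift-cong n (⊛-identityˡ g) r)) ⟩
      Δ n g r                                ∎

  alcoveSeries : ∀ {m} → Vec ℕ m → FPS
  alcoveSeries ns q = + alcoveCount ns q

  -- `alcoveCount-+` read on series: the mark `n` contributes `t^n / (1 - t^n)`. Below degree `n`
  -- both sides vanish.
  Δ-alcoveSeries : ∀ {m} n (ns : Vec ℕ m) → 0 ℕ.< n → Δ n (alcoveSeries (n ∷ ns)) ≗ shift n (alcoveSeries ns)
  Δ-alcoveSeries n ns 0<n q with ℕₚ.<-≤-connex q n
  ... | inj₁ q<n = trans (cong₂ (λ a b → + a - b) (alcoveCount-small n ns (ℕₚ.<⇒≤ q<n)) (shift-< n (alcoveSeries (n ∷ ns)) q<n))
                     (sym (shift-< n (alcoveSeries ns) q<n))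
  ... | inj₂ n≤q with r , refl ← ℕₚ.m≤n⇒∃[o]m+o≡n n≤q = begin
    + alcoveCount (n ∷ ns) (n ℕ.+ r) - shift n (alcoveSeries (n ∷ ns)) (n ℕ.+ r)
      ≡⟨ cong₂ (λ a b → + a - b) (alcoveCount-+ n ns r 0<n) (shift-+ n (alcoveSeries (n ∷ ns)) r) ⟩
    + (alcoveCount ns r ℕ.+ alcoveCount (n ∷ ns) r) - + alcoveCount (n ∷ ns) r
      ≡⟨ cong (_- + alcoveCount (n ∷ ns) r) (ℤₚ.pos-+ (alcoveCount ns r) (alcoveCount (n ∷ ns) r)) ⟩
    (+ alcoveCount ns r + + alcoveCount (n ∷ ns) r) - + alcoveCount (n ∷ ns) r
      ≡⟨ lemma (+ alcoveCount ns r) (+ alcoveCount (n ∷ ns) r) ⟩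
    + alcoveCount ns r
      ≡⟨ shift-+ n (alcoveSeries ns) r ⟨
    shift n (alcoveSeries ns) (n ℕ.+ r) ∎
    where
    open ≡-Reasoning
    lemma : ∀ a b → (a + b) - b ≡ a
    lemma = solve-∀

  Δ-shift : ∀ n a (f : FPS) → Δ n (shift a f) ≗ shift a (Δ n f)
  Δ-shift n a f q = trans (cong (_-_ (shift a f q)) (shift-comm n a f q)) (sym (shift-- a f (shift n f) q))

  Δ-comm : ∀ n a (f : FPS) → Δ n (Δ a f) ≗ Δ a (Δ n f)
  Δ-comm n a f q = begin
    Δ a f q - shift n (Δ a f) q                                      ≡⟨ cong (_-_ (Δ a f q)) (shift-- n f (shift a f) q) ⟩
    (f q - shift a f q) - (shift n f q - shift n (shift a f) q)      ≡⟨ cong (λ t → (f q - shift a f q) - (shift n f q - t)) (shift-comm n a f q) ⟩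
    (f q - shift a f q) - (shift n f q - shift a (shift n f) q)      ≡⟨ lemma (f q) (shift a f q) (shift n f q) _ ⟩
    (f q - shift n f q) - (shift a f q - shift a (shift n f) q)      ≡⟨ cong (_-_ (Δ n f q)) (shift-- a f (shift n f) q) ⟨
    Δ n f q - shift a (Δ n f) q                                      ∎
    where
    open ≡-Reasoning
    lemma : ∀ x a b c → (x - a) - (b - c) ≡ (x - b) - (a - c)
    lemma = solve-∀

  Δ-* : ∀ n c (f : FPS) → Δ n (λ q → c * f q) ≗ λ q → c * Δ n f q
  Δ-* n c f q = trans (cong (_-_ (c * f q)) (shift-* n c f q)) (lemma c (f q) (shift n f q))
    where
    lemma : ∀ c a b → c * a - c * b ≡ c * (a - b)
    lemma = solve-∀

  -- In rank zero the series is `t / (1 - t)`; its numerator is the extra `1` in the exponent `h`.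
  Δ1-alcoveSeries-[] : ∀ c → (λ q → c * Δ 1 (alcoveSeries []) q) ≗ monomial c 1
  Δ1-alcoveSeries-[] c zero          = ℤₚ.*-zeroʳ c
  Δ1-alcoveSeries-[] c (suc zero)    = ℤₚ.*-identityʳ c
  Δ1-alcoveSeries-[] c (suc (suc q)) = ℤₚ.*-zeroʳ c

  -- The exponent `a` accumulates the marks already absorbed. `Δ 1` is carried along because `1 - t`
  -- is multiplied in before the other factors but cancels only at rank zero.
  alcoveSeries-⊛ : ∀ {m} (ns : Vec ℕ m) → (∀ i → 0 ℕ.< lookup ns i) → ∀ c a {f} →
    f ≗ shift a (λ q → c * Δ 1 (alcoveSeries ns) q) →
    f ⊛ prodFPS (List.map oneMinusT^ (Vec.toList ns)) ≗ monomial c (suc (a ℕ.+ Vec.sum ns))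
  alcoveSeries-⊛ []       _    c a {f} eq q = begin
    (f ⊛ one) q                                       ≡⟨ ⊛-identityʳ f q ⟩
    f q                                               ≡⟨ eq q ⟩
    shift a (λ q → c * Δ 1 (alcoveSeries []) q) q     ≡⟨ shift-cong a (Δ1-alcoveSeries-[] c) q ⟩
    shift a (monomial c 1) q                          ≡⟨ shift-monomial a c 1 q ⟩
    monomial c (a ℕ.+ 1) q                            ≡⟨ cong (λ k → monomial c k q) (ℕₚ.+-suc a 0) ⟩
    monomial c (suc (a ℕ.+ 0)) q                      ∎
    where open ≡-Reasoning
  alcoveSeries-⊛ (n ∷ ns) ns>0 c a {f} eq q = begin
    (f ⊛ (oneMinusT^ n ⊛ P)) q                        ≡⟨ ⊛-oneMinusT^ n f P q ⟩
    (Δ n f ⊛ P) q                                     ≡⟨ alcoveSeries-⊛ ns (ns>0 ∘ Fin.suc) c (a ℕ.+ n) step q ⟩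
    monomial c (suc (a ℕ.+ n ℕ.+ Vec.sum ns)) q       ≡⟨ cong (λ k → monomial c (suc k) q) (ℕₚ.+-assoc a n (Vec.sum ns)) ⟩
    monomial c (suc (a ℕ.+ (n ℕ.+ Vec.sum ns))) q     ∎
    where
    open ≡-Reasoning
    P = prodFPS (List.map oneMinusT^ (Vec.toList ns))
    S = alcoveSeries ns
    S′ = alcoveSeries (n ∷ ns)
    cΔ : ∀ q → Δ n (λ q → c * Δ 1 S′ q) q ≡ shift n (λ q → c * Δ 1 S q) q
    cΔ q = begin
      Δ n (λ q → c * Δ 1 S′ q) q       ≡⟨ Δ-* n c (Δ 1 S′) q ⟩
      c * Δ n (Δ 1 S′) q               ≡⟨ cong (c *_) (Δ-comm n 1 S′ q) ⟩
      c * Δ 1 (Δ n S′) q               ≡⟨ cong (c *_) (Δ-cong 1 (Δ-alcoveSeries n ns (ns>0 Fin.zero)) q) ⟩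
      c * Δ 1 (shift n S) q            ≡⟨ cong (c *_) (Δ-shift 1 n S q) ⟩
      c * shift n (Δ 1 S) q            ≡⟨ shift-* n c (Δ 1 S) q ⟨
      shift n (λ q → c * Δ 1 S q) q    ∎
    step : Δ n f ≗ shift (a ℕ.+ n) (λ q → c * Δ 1 S q)
    step q = begin
      Δ n f q                                          ≡⟨ Δ-cong n eq q ⟩
      Δ n (shift a (λ q → c * Δ 1 S′ q)) q             ≡⟨ Δ-shift n a (λ q → c * Δ 1 S′ q) q ⟩
      shift a (Δ n (λ q → c * Δ 1 S′ q)) q             ≡⟨ shift-cong a cΔ q ⟩
      shift a (shift n (λ q → c * Δ 1 S q)) q          ≡⟨ shift-shift a n (λ q → c * Δ 1 S q) q ⟩
      shift (a ℕ.+ n) (λ q → c * Δ 1 S q) q            ∎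

open GeneratingFunction
open import Data.Nat using (_+_; _*_; z≤n; s≤s)

-- Assembly of the formula for `Φ`.

Φ-alcoveSeries : ∀ {m} {G : Gram m} {R : List (Vec ℤ m)} (system : IsIrredRootSystem m G R)
                 (ns : Vec ℕ m) → IsHighestRoot R (Vec.map +_ ns) →
                 Φ R ≗ λ q → + volume ns ℤ.* alcoveSeries ns q
-- The factorisation of `χ` covers positive `q` only; the constant terms both vanish.
Φ-alcoveSeries system ns highest zero    = sym (trans (cong (λ c → + volume ns ℤ.* + c) (alcoveCount-zero ns)) (ℤₚ.*-zeroʳ (+ volume ns)))
Φ-alcoveSeries {R = R} system ns highest (suc q) = begin
  + χ R (suc q)                                                 ≡⟨ cong +_ (χ-alcoveCount system ns highest (suc q) (s≤s z≤n)) ⟩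
  + (χ R (suc (Vec.sum ns)) * alcoveCount ns (suc q))           ≡⟨ cong (λ N → + (N * alcoveCount ns (suc q))) (χ-coxeter system ns highest) ⟩
  + (volume ns * alcoveCount ns (suc q))                        ≡⟨ ℤₚ.pos-* (volume ns) (alcoveCount ns (suc q)) ⟩
  + volume ns ℤ.* alcoveSeries ns (suc q)                       ∎
  where open ≡-Reasoning

Φ-rational : ∀ {m} {G : Gram m} {R : List (Vec ℤ m)} (system : IsIrredRootSystem m G R)
             (ns : Vec ℕ m) → IsHighestRoot R (Vec.map +_ ns) →
             Φ R ⊛ (oneMinusT^ 1 ⊛ prodFPS (List.map oneMinusT^ (Vec.toList ns))) ≗
             monomial (+ volume ns) (suc (Vec.sum ns))
Φ-rational {R = R} system ns highest q = trans
  (⊛-oneMinusT^ 1 (Φ R) (prodFPS (List.map oneMinusT^ (Vec.toList ns))) q)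
  (alcoveSeries-⊛ ns (marks-positive system ns highest) (+ volume ns) 0
    (λ r → trans (Δ-cong 1 (Φ-alcoveSeries system ns highest) r) (Δ-* 1 (+ volume ns) (alcoveSeries ns) r)) q)

marks-toList : ∀ {m} (θ : Vec ℤ m) → List.map (λ i → ∣ lookup θ i ∣) (allFin m) ≡ Vec.toList (Vec.map ∣_∣ θ)
marks-toList {m} θ = trans (map-tabulate id (λ i → ∣ lookup θ i ∣)) (go θ)
  where
  go : ∀ {m} (θ : Vec ℤ m) → List.tabulate (λ i → ∣ lookup θ i ∣) ≡ Vec.toList (Vec.map ∣_∣ θ)
  go []      = refl
  go (x ∷ θ) = cong (∣ x ∣ ∷_) (go θ)

prodℕ-toList : ∀ {m} (ns : Vec ℕ m) → prodℕ (Vec.toList ns) ≡ vecProduct ns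
prodℕ-toList []       = refl
prodℕ-toList (n ∷ ns) = cong (n *_) (prodℕ-toList ns)

sumℕ-toList : ∀ {m} (ns : Vec ℕ m) → sumℕ (Vec.toList ns) ≡ Vec.sum ns
sumℕ-toList []       = refl
sumℕ-toList (n ∷ ns) = cong (_+_ n) (sumℕ-toList ns)

-- The marks enter the theorem as absolute values; positivity of the highest root makes this
-- lossless.
map-+-∣∣ : ∀ {m} {θ : Vec ℤ m} → Positive θ → Vec.map +_ (Vec.map ∣_∣ θ) ≡ θ
map-+-∣∣ {θ = []}    θ>0 = refl
map-+-∣∣ {θ = x ∷ θ} θ>0 = cong₂ _∷_ (ℤₚ.0≤i⇒+∣i∣≡i (ℤₚ.<⇒≤ (θ>0 Fin.zero))) (map-+-∣∣ {θ = θ} (θ>0 ∘ Fin.suc))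

theorem3p1 : (m : ℕ) (G : Gram m) (R : List (Vec ℤ m)) →
    IsIrredRootSystem m G R →
    (θ : Vec ℤ m) → IsHighestRoot R θ →
    let nᵢ = map (λ i → ∣ lookup θ i ∣) (allFin m)
        h  = suc (sumℕ nᵢ)
    in ∀ q → (Φ R ⊛ (oneMinusT^ 1 ⊛ prodFPS (map oneMinusT^ nᵢ))) q
             ≡ monomial (+ (prodℕ nᵢ * (m !))) h q
theorem3p1 m G R system θ highest q
  rewrite marks-toList θ | prodℕ-toList (Vec.map ∣_∣ θ) | sumℕ-toList (Vec.map ∣_∣ θ) =
  Φ-rational system (Vec.map ∣_∣ θ)
    (subst (IsHighestRoot R) (sym (map-+-∣∣ (highest-positive system highest))) highest) q
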